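{- Let $q$ be a fixed nonzero complex number with $|q|<1$, let $r>0$, and let $d\ge 2$ be an integer. Let $a_1,\dots,a_d$ be complex-valued functions on the closed disc $\{z\in\mathbb{C}: |z|\le r\}$, and put $w_i=a_i(0)$ for $i=1,\dots,d$. Suppose that there exists a real number $M>0$ such that $$|a_i(z)-w_i|\le M|z|,\qquad 1\le i\le d,\ |z|\le r,$$ and that $$|w_d|+|w_{d-1}+w_d|+\cdots+|w_2+\cdots+w_d|<1,$$ $$w_1+w_2+\cdots+w_d=1.$$ Let $f$ be a continuous complex-valued function on the disc $|z|\le r$ satisfying the recurrence relation $$f(z)=a_1(z)f(zq)+a_2(z)f(zq^2)+\cdots+a_d(z)f(zq^d)\qquad\text{for all } |z|\le r.$$ Then $f$ is uniquely determined by $f(0)$ and the functions $a_1,\dots,a_d$; that is, if $g$ is any continuous complex-valued function on $|z|\le r$ satisfying the same recurrence relation $g(z)=\sum_{i=1}^d a_i(z)g(zq^i)$ for all $|z|\le r$, and $g(0)=f(0)$, then $g(z)=f(z)$ for all $|z|\le r$.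
   Context: The first sum condition is the sum over $i=2,\dots,d$ of the absolute values of the tail sums: $\sum_{i=2}^{d}\left|\sum_{j=i}^{d} w_j\right|<1$. -}

module Defs where

open import Algebra.Bundles using (RawMonoid)
open import Algebra.Bundles.Raw using (RawSemiring)
import Algebra.Definitions.RawMonoid as RawMonoidDefs
import Algebra.Definitions.RawSemiring as RawSemiringDefs
open import Data.Fin.Base using (Fin; toℕ)
import Data.Integer.Base as ℤ
import Data.Integer.Properties as ℤ
open import Data.Nat.Base as ℕ using (ℕ; zero; suc)
import Data.Nat.Properties as ℕ
open import Data.Product.Base using (∃; _×_; _,_; proj₁; proj₂)
open import Data.Rational.Base as ℚ using (ℚ; mkℚ; 0ℚ; 1ℚ; ½; toℚᵘ)
import Data.Rational.Properties as ℚ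
open import Data.Rational.Solver using (module +-*-Solver)
import Data.Rational.Unnormalised.Base as ℚᵘ
import Data.Rational.Unnormalised.Properties as ℚᵘ
open import Data.Sum.Base using (inj₁; inj₂)
open import Data.Vec.Functional using (Vector; tail)
open import Function.Bundles using (Func; _⟶ₛ_; _⟨$⟩_)
open import Level using (0ℓ)
open import Relation.Binary.Bundles using (Setoid)
open import Relation.Binary.PropositionalEquality
  using (_≡_; refl; sym; trans; cong; cong₂; subst; subst₂)
open import Relation.Nullary.Decidable using (yes; no)

module Rational where

  open import Data.Rational.Base using (_+_; _*_; _-_; -_; _≤_; _<_; _⊔_; ∣_∣)
  open +-*-Solver

  0≤⇒≤ : ∀ {p q} → 0ℚ ≤ q - p → p ≤ q
  0≤⇒≤ {p} {q} h = subst₂ _≤_ (ℚ.+-identityˡ p)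
    (solve 2 (λ p q → (q :- p) :+ p := q) refl p q) (ℚ.+-monoˡ-≤ p h)

  ≤⇒0≤ : ∀ {p q} → p ≤ q → 0ℚ ≤ q - p
  ≤⇒0≤ {p} {q} h = subst (_≤ q - p) (ℚ.+-inverseʳ p) (ℚ.+-monoˡ-≤ (- p) h)

  0≤+ : ∀ {p q} → 0ℚ ≤ p → 0ℚ ≤ q → 0ℚ ≤ p + q
  0≤+ = ℚ.+-mono-≤

  0≤* : ∀ {p q} → 0ℚ ≤ p → 0ℚ ≤ q → 0ℚ ≤ p * q
  0≤* {p} {q} hp hq = subst (_≤ p * q) (ℚ.*-zeroʳ p)
    (ℚ.*-monoˡ-≤-nonNeg p {{ℚ.nonNegative hp}} hq)

  0<* : ∀ {p q} → 0ℚ < p → 0ℚ < q → 0ℚ < p * q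
  0<* {p} {q} hp hq = subst (_< p * q) (ℚ.*-zeroʳ p)
    (ℚ.*-monoʳ-<-pos p {{ℚ.positive hp}} hq)

  0≤p² : ∀ p → 0ℚ ≤ p * p
  0≤p² p with ℚ.≤-total 0ℚ p
  ... | inj₁ h = 0≤* h h
  ... | inj₂ h = subst (0ℚ ≤_) (solve 1 (λ p → (con 0ℚ :- p) :* (con 0ℚ :- p) := p :* p) refl p)
                   (0≤* (≤⇒0≤ h) (≤⇒0≤ h))

  -- Certificate: p ≤ q because q - p is a sum of terms known to be ≥ 0.
  by : ∀ {p q} s → q - p ≡ s → 0ℚ ≤ s → p ≤ q
  by s eq h = 0≤⇒≤ (subst (0ℚ ≤_) (sym eq) h)

  *-mono-≤ : ∀ {p q s t} → 0ℚ ≤ p → 0ℚ ≤ t → p ≤ q → s ≤ t → p * s ≤ q * t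
  *-mono-≤ {p} {q} {s} {t} 0≤p 0≤t p≤q s≤t =
    by (p * (t - s) + (q - p) * t)
       (solve 4 (λ p q s t → q :* t :- p :* s := p :* (t :- s) :+ (q :- p) :* t) refl p q s t)
       (0≤+ (0≤* 0≤p (≤⇒0≤ s≤t)) (0≤* (≤⇒0≤ p≤q) 0≤t))

  sq-cancel-≤ : ∀ {p q} → 0ℚ ≤ q → p * p ≤ q * q → p ≤ q
  sq-cancel-≤ {p} {q} 0≤q h = ℚ.≮⇒≥ λ q<p →
    let 0<p = ℚ.≤-<-trans 0≤q q<p in
    ℚ.<-irrefl refl
      (ℚ.<-≤-trans
        (ℚ.≤-<-trans (*-mono-≤ 0≤q (ℚ.<⇒≤ 0<p) ℚ.≤-refl (ℚ.<⇒≤ q<p))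
                     (ℚ.*-monoˡ-<-pos p {{ℚ.positive 0<p}} q<p))
        h)

  p≤p+ : ∀ p {q} → 0ℚ ≤ q → p ≤ p + q
  p≤p+ p {q} h = subst (_≤ p + q) (ℚ.+-identityʳ p) (ℚ.+-monoʳ-≤ p h)

  p≤∣p∣ : ∀ p → p ≤ ∣ p ∣
  p≤∣p∣ p with ℚ.≤-total 0ℚ p
  ... | inj₁ h = ℚ.≤-reflexive (sym (ℚ.0≤p⇒∣p∣≡p h))
  ... | inj₂ h = ℚ.≤-trans h (ℚ.0≤∣p∣ p)

  ∣p-q∣≡∣q-p∣ : ∀ p q → ∣ p - q ∣ ≡ ∣ q - p ∣
  ∣p-q∣≡∣q-p∣ p q = trans (sym (ℚ.∣-p∣≡∣p∣ (p - q)))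
    (cong ∣_∣ (solve 2 (λ p q → :- (p :- q) := q :- p) refl p q))

  ∣p-q∣≤⇒p≤q+ : ∀ {p q e} → ∣ p - q ∣ ≤ e → p ≤ q + e
  ∣p-q∣≤⇒p≤q+ {p} {q} {e} h =
    by (e - (p - q)) (solve 3 (λ p q e → q :+ e :- p := e :- (p :- q)) refl p q e)
       (≤⇒0≤ (ℚ.≤-trans (p≤∣p∣ (p - q)) h))

  p≤q+⇒∣p-q∣≤ : ∀ {p q e} → p ≤ q + e → q ≤ p + e → ∣ p - q ∣ ≤ e
  p≤q+⇒∣p-q∣≤ {p} {q} {e} h k with ℚ.∣p∣≡p∨∣p∣≡-p (p - q)
  ... | inj₁ eq = subst (_≤ e) (sym eq)
    (by (q + e - p) (solve 3 (λ p q e → e :- (p :- q) := q :+ e :- p) refl p q e) (≤⇒0≤ h))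
  ... | inj₂ eq = subst (_≤ e) (sym eq)
    (by (p + e - q) (solve 3 (λ p q e → e :- (:- (p :- q)) := p :+ e :- q) refl p q e) (≤⇒0≤ k))

  ∣p-p∣≡0 : ∀ p → ∣ p - p ∣ ≡ 0ℚ
  ∣p-p∣≡0 p = cong ∣_∣ (ℚ.+-inverseʳ p)

  ∣p*q∣≤ : ∀ p q {s t} → 0ℚ ≤ s → ∣ p ∣ ≤ s → ∣ q ∣ ≤ t → ∣ p * q ∣ ≤ s * t
  ∣p*q∣≤ p q {s} {t} 0≤s h k = subst (_≤ s * t) (sym (ℚ.∣p*q∣≡∣p∣*∣q∣ p q))
    (*-mono-≤ (ℚ.0≤∣p∣ p) (ℚ.≤-trans (ℚ.0≤∣p∣ q) k) h k)

  *-close : ∀ a b c d {s t u v} → 0ℚ ≤ s → 0ℚ ≤ t → ∣ a ∣ ≤ s → ∣ d ∣ ≤ t →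
    ∣ b - d ∣ ≤ u → ∣ a - c ∣ ≤ v → ∣ a * b - c * d ∣ ≤ s * u + t * v
  *-close a b c d {s} {t} {u} {v} 0≤s 0≤t ha hd hu hv =
    subst (λ p → ∣ p ∣ ≤ s * u + t * v)
      (solve 4 (λ a b c d → a :* (b :- d) :+ d :* (a :- c) := a :* b :- c :* d) refl a b c d)
      (ℚ.≤-trans (ℚ.∣p+q∣≤∣p∣+∣q∣ (a * (b - d)) (d * (a - c)))
        (ℚ.+-mono-≤ (∣p*q∣≤ a (b - d) 0≤s ha hu) (∣p*q∣≤ d (a - c) 0≤t hd hv)))

  0<½ : 0ℚ < ½
  0<½ = ℚ.positive⁻¹ ½

  0<½* : ∀ {p} → 0ℚ < p → 0ℚ < ½ * p
  0<½* = 0<* 0<½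

  ½+½ : ∀ p → ½ * p + ½ * p ≡ p
  ½+½ = solve 1 (λ p → con ½ :* p :+ con ½ :* p := p) refl

  quotient : ∀ {p q} → 0ℚ < p → 0ℚ < q → ∃ λ s → 0ℚ < s × p * s ≡ q
  quotient {p} {q} 0<p 0<q = q * ℚ.1/ p
    , 0<* 0<q (ℚ.positive⁻¹ (ℚ.1/ p) {{ℚ.1/pos⇒pos p}})
    , trans (solve 3 (λ p q i → p :* (q :* i) := q :* (p :* i)) refl p q (ℚ.1/ p))
            (trans (cong (q *_) (ℚ.*-inverseʳ p)) (ℚ.*-identityʳ q))
    where instance
      pos = ℚ.positive 0<p
      nz  = ℚ.pos⇒nonZero p

  fromℕ : ℕ → ℚ
  fromℕ zero    = 0ℚ
  fromℕ (suc n) = 1ℚ + fromℕ n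

  fromℕ-mono : ∀ {m n} → m ℕ.≤ n → fromℕ m ≤ fromℕ n
  fromℕ-mono {n = zero}  ℕ.z≤n     = ℚ.≤-refl
  fromℕ-mono {n = suc n} ℕ.z≤n     = 0≤+ (ℚ.nonNegative⁻¹ 1ℚ) (fromℕ-mono {n = n} ℕ.z≤n)
  fromℕ-mono             (ℕ.s≤s h) = ℚ.+-monoʳ-≤ 1ℚ (fromℕ-mono h)

  toℚᵘ-fromℕ : ∀ n → toℚᵘ (fromℕ n) ℚᵘ.≃ ℚᵘ.mkℚᵘ (ℤ.+ n) 0
  toℚᵘ-fromℕ zero    = ℚᵘ.≃-refl
  toℚᵘ-fromℕ (suc n) = ℚᵘ.≃-trans (ℚ.toℚᵘ-homo-+ 1ℚ (fromℕ n))
    (ℚᵘ.≃-trans (ℚᵘ.+-congʳ ℚᵘ.1ℚᵘ (toℚᵘ-fromℕ n))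
      (ℚᵘ.*≡* (cong (λ k → (ℤ.1ℤ ℤ.+ k) ℤ.* ℤ.1ℤ) (ℤ.*-identityʳ (ℤ.+ n)))))

  archimedean : ∀ p → ∃ λ n → p ≤ fromℕ n
  archimedean p@(mkℚ (ℤ.+ n) d _) = n , ℚ.toℚᵘ-cancel-≤
    (ℚᵘ.≤-trans (ℚᵘ.*≤* (ℤ.*-monoˡ-≤-nonNeg (ℤ.+ n) (ℤ.+≤+ (ℕ.s≤s ℕ.z≤n))))
                (ℚᵘ.≤-reflexive (ℚᵘ.≃-sym (toℚᵘ-fromℕ n))))
  archimedean p@(mkℚ ℤ.-[1+ n ] d _) = 0 , ℚ.nonPositive⁻¹ p

  width : ℚ → ℕ → ℚ
  width p zero    = p + 1ℚ
  width p (suc n) = ½ * width p n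

  -- Bisection: for p ≥ 0, √p lies between  lower p n  and  lower p n + width p n.
  lower : ℚ → ℕ → ℚ
  lower p zero    = 0ℚ
  lower p (suc n) with (lower p n + width p (suc n)) * (lower p n + width p (suc n)) ℚ.≤? p
  ... | yes _ = lower p n + width p (suc n)
  ... | no  _ = lower p n

  module _ {p} (0≤p : 0ℚ ≤ p) where

    0≤width : ∀ n → 0ℚ ≤ width p n
    0≤width zero    = 0≤+ {p} {1ℚ} 0≤p (ℚ.nonNegative⁻¹ 1ℚ)
    0≤width (suc n) = 0≤* {½} {width p n} (ℚ.<⇒≤ 0<½) (0≤width n)

    0≤lower : ∀ n → 0ℚ ≤ lower p n
    0≤lower zero = ℚ.≤-refl
    0≤lower (suc n) with (lower p n + width p (suc n)) * (lower p n + width p (suc n)) ℚ.≤? p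
    ... | yes _ = 0≤+ {lower p n} {width p (suc n)} (0≤lower n) (0≤width (suc n))
    ... | no  _ = 0≤lower n

    lower²≤ : ∀ n → lower p n * lower p n ≤ p
    lower²≤ zero = 0≤p
    lower²≤ (suc n) with (lower p n + width p (suc n)) * (lower p n + width p (suc n)) ℚ.≤? p
    ... | yes h = h
    ... | no  _ = lower²≤ n

    ≤upper² : ∀ n → p ≤ (lower p n + width p n) * (lower p n + width p n)
    ≤upper² zero =
      by (p * p + p + 1ℚ)
         (solve 1 (λ p → (con 0ℚ :+ (p :+ con 1ℚ)) :* (con 0ℚ :+ (p :+ con 1ℚ)) :- p
                         := p :* p :+ p :+ con 1ℚ) refl p)
         (0≤+ (0≤+ (0≤p² p) 0≤p) (ℚ.nonNegative⁻¹ 1ℚ))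
    ≤upper² (suc n) with (lower p n + width p (suc n)) * (lower p n + width p (suc n)) ℚ.≤? p
    ... | no  h = ℚ.<⇒≤ (ℚ.≰⇒> h)
    ... | yes _ = subst (λ t → p ≤ t * t)
      (solve 2 (λ l w → l :+ w := l :+ con ½ :* w :+ con ½ :* w) refl (lower p n) (width p n))
      (≤upper² n)

    width≤ : ∀ n → width p n ≤ p + 1ℚ
    width≤ zero    = ℚ.≤-refl
    width≤ (suc n) =
      by (½ * (p + 1ℚ) + ½ * (p + 1ℚ - width p n))
         (solve 2 (λ c w → c :- con ½ :* w := con ½ :* c :+ con ½ :* (c :- w))
                refl (p + 1ℚ) (width p n))
         (0≤+ (0≤* (ℚ.<⇒≤ 0<½) (0≤width 0)) (0≤* (ℚ.<⇒≤ 0<½) (≤⇒0≤ (width≤ n))))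

    n*width≤ : ∀ n → fromℕ n * width p n ≤ p + 1ℚ
    n*width≤ zero    = subst (_≤ p + 1ℚ) (sym (ℚ.*-zeroˡ (p + 1ℚ))) (0≤width 0)
    n*width≤ (suc n) =
      by (½ * (p + 1ℚ - fromℕ n * width p n) + ½ * (p + 1ℚ - width p n))
         (solve 3 (λ c k w → c :- (con 1ℚ :+ k) :* (con ½ :* w)
                             := con ½ :* (c :- k :* w) :+ con ½ :* (c :- w))
                refl (p + 1ℚ) (fromℕ n) (width p n))
         (0≤+ (0≤* (ℚ.<⇒≤ 0<½) (≤⇒0≤ (n*width≤ n))) (0≤* (ℚ.<⇒≤ 0<½) (≤⇒0≤ (width≤ n))))

  width-small : ∀ {b e} → 0ℚ < b → 0ℚ < e →
    ∃ λ N → ∀ n → N ℕ.≤ n → ∀ {p} → 0ℚ ≤ p → p ≤ b → width p n ≤ e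
  width-small {b} {e} 0<b 0<e = suc (proj₁ k) , small
    where
    0<b+1 : 0ℚ < b + 1ℚ
    0<b+1 = ℚ.+-mono-< 0<b (ℚ.positive⁻¹ 1ℚ)
    c = quotient 0<e 0<b+1
    k = archimedean (proj₁ c)
    small : ∀ n → suc (proj₁ k) ℕ.≤ n → ∀ {p} → 0ℚ ≤ p → p ≤ b → width p n ≤ e
    small n k<n {p} 0≤p p≤b = ℚ.*-cancelˡ-≤-pos (fromℕ n) {{ℚ.positive 0<n}}
      (ℚ.≤-trans (n*width≤ 0≤p n)
        (ℚ.≤-trans (ℚ.+-monoˡ-≤ 1ℚ p≤b)
          (subst₂ _≤_ (proj₂ (proj₂ c)) (ℚ.*-comm e (fromℕ n))
            (ℚ.*-monoˡ-≤-nonNeg e {{ℚ.nonNegative (ℚ.<⇒≤ 0<e)}} c≤n))))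
      where
      c≤n : proj₁ c ≤ fromℕ n
      c≤n = ℚ.≤-trans (proj₂ k) (fromℕ-mono (ℕ.≤-trans (ℕ.n≤1+n _) k<n))
      0<n : 0ℚ < fromℕ n
      0<n = ℚ.<-≤-trans (proj₁ (proj₂ c)) c≤n

  lower-close : ∀ {p q e} m n → 0ℚ ≤ p → 0ℚ ≤ q → 0ℚ ≤ e →
    p ≤ q + e * e → width q n ≤ e → lower p m ≤ lower q n + (e + e)
  lower-close {p} {q} {e} m n 0≤p 0≤q 0≤e p≤ w≤ =
    sq-cancel-≤ (0≤+ 0≤l (0≤+ 0≤e 0≤e))
      (ℚ.≤-trans (lower²≤ 0≤p m) (ℚ.≤-trans p≤
        (ℚ.≤-trans (ℚ.+-monoˡ-≤ (e * e) q≤)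
          (by ((l * e + l * e) + (e * e + e * e))
              (solve 2 (λ l e → (l :+ (e :+ e)) :* (l :+ (e :+ e)) :- ((l :+ e) :* (l :+ e) :+ e :* e)
                                := (l :* e :+ l :* e) :+ (e :* e :+ e :* e)) refl l e)
              (0≤+ (0≤+ (0≤* 0≤l 0≤e) (0≤* 0≤l 0≤e)) (0≤+ (0≤p² e) (0≤p² e)))))))
    where
    l = lower q n
    0≤l = 0≤lower 0≤q n
    q≤ : q ≤ (l + e) * (l + e)
    q≤ = ℚ.≤-trans (≤upper² 0≤q n)
           (*-mono-≤ (0≤+ 0≤l (0≤width 0≤q n)) (0≤+ 0≤l 0≤e)
                     (ℚ.+-monoʳ-≤ l w≤) (ℚ.+-monoʳ-≤ l w≤))

  ⊔0-close : ∀ {p q e} → 0ℚ ≤ e → p ≤ q + e → p ⊔ 0ℚ ≤ (q ⊔ 0ℚ) + e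
  ⊔0-close {p} {q} {e} 0≤e h = ℚ.⊔-lub
    (ℚ.≤-trans h (ℚ.+-monoˡ-≤ e (ℚ.p≤p⊔q q 0ℚ)))
    (0≤+ (ℚ.p≤q⊔p q 0ℚ) 0≤e)

  lower-⊔0-close : ∀ p q {e} m n → 0ℚ < e → p ≤ q + (½ * e) * (½ * e) →
    width (q ⊔ 0ℚ) n ≤ ½ * e → lower (p ⊔ 0ℚ) m ≤ lower (q ⊔ 0ℚ) n + e
  lower-⊔0-close p q {e} m n 0<e p≤ w≤ =
    subst (λ t → lower (p ⊔ 0ℚ) m ≤ lower (q ⊔ 0ℚ) n + t) (½+½ e)
      (lower-close m n (ℚ.p≤q⊔p p 0ℚ) (ℚ.p≤q⊔p q 0ℚ) (ℚ.<⇒≤ (0<½* 0<e))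
        (⊔0-close {p} {q} (0≤p² (½ * e)) p≤) w≤)

  width-⊔0-small : ∀ {b e} → 0ℚ < b → 0ℚ < e →
    ∃ λ N → ∀ n → N ℕ.≤ n → ∀ p → ∣ p ∣ ≤ b → width (p ⊔ 0ℚ) n ≤ e
  width-⊔0-small 0<b 0<e = proj₁ (width-small 0<b 0<e) , λ n N≤n p h →
    proj₂ (width-small 0<b 0<e) n N≤n (ℚ.p≤q⊔p p 0ℚ)
      (ℚ.⊔-lub (ℚ.≤-trans (p≤∣p∣ p) h) (ℚ.<⇒≤ 0<b))

  lower-⊔0-≤1 : ∀ p {e} n → lower (p ⊔ 0ℚ) n + e ≤ 1ℚ → width (p ⊔ 0ℚ) n ≤ e → p ≤ 1ℚ
  lower-⊔0-≤1 p {e} n l≤ w≤ = ℚ.≤-trans (ℚ.p≤p⊔q p 0ℚ) (ℚ.≤-trans (≤upper² 0≤p⁺ n)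
    (*-mono-≤ {u} {1ℚ} {u} {1ℚ} (0≤+ {l} {w} (0≤lower 0≤p⁺ n) (0≤width 0≤p⁺ n))
              (ℚ.nonNegative⁻¹ 1ℚ) u≤1 u≤1))
    where
    0≤p⁺ = ℚ.p≤q⊔p p 0ℚ
    l = lower (p ⊔ 0ℚ) n
    w = width (p ⊔ 0ℚ) n
    u = l + w
    u≤1 : u ≤ 1ℚ
    u≤1 = ℚ.≤-trans (ℚ.+-monoʳ-≤ l w≤) l≤

  lower-0-≤ : ∀ n {p d e} → 0ℚ < d → 0ℚ < e → 0ℚ + d ≤ p → lower 0ℚ n ≤ p + e
  lower-0-≤ n {p} {d} {e} 0<d 0<e h = ℚ.≤-trans
    (sq-cancel-≤ {lower 0ℚ n} {0ℚ} ℚ.≤-refl (lower²≤ {0ℚ} ℚ.≤-refl n))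
    (0≤+ {p} {e} (ℚ.≤-trans (0≤+ {0ℚ} {d} ℚ.≤-refl (ℚ.<⇒≤ 0<d)) h) (ℚ.<⇒≤ 0<e))

  *-≤1 : ∀ p q → 0ℚ ≤ p → q ≤ 1ℚ → p * q ≤ p
  *-≤1 p q 0≤p q≤1 = subst (p * q ≤_) (ℚ.*-identityʳ p)
    (ℚ.*-monoˡ-≤-nonNeg p {{ℚ.nonNegative 0≤p}} q≤1)

  0≤p²+q² : ∀ p q → 0ℚ ≤ p * p + q * q
  0≤p²+q² p q = 0≤+ {p * p} {q * q} (0≤p² p) (0≤p² q)

  two-squares : ∀ a b c d →
    (a * c + - (b * d)) * (a * c + - (b * d)) + (a * d + b * c) * (a * d + b * c)
      ≡ (a * a + b * b) * (c * c + d * d)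
  two-squares = solve 4
    (λ a b c d → (a :* c :+ :- (b :* d)) :* (a :* c :+ :- (b :* d)) :+ (a :* d :+ b :* c) :* (a :* d :+ b :* c)
                 := (a :* a :+ b :* b) :* (c :* c :+ d :* d)) refl

open Rational

IsCauchy : (ℕ → ℚ) → Set
IsCauchy x = ∀ ε → 0ℚ ℚ.< ε →
  ∃ λ N → ∀ m n → N ℕ.≤ m → N ℕ.≤ n → ℚ.∣ x m ℚ.- x n ∣ ℚ.≤ ε

-- A real is a Cauchy sequence of rationals, taken up to _≈ᴿ_.
-- Without eta, comparing two reals never unfolds their Cauchy proofs.
record ℝ : Set where
  no-eta-equality
  constructor mkℝ
  field
    seq    : ℕ → ℚ
    cauchy : IsCauchy seq

open ℝ public

Eventually : (ℕ → Set) → Set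
Eventually P = ∃ λ N → ∀ n → N ℕ.≤ n → P n

infix 4 _≈ᴿ_ _≤ᴿ_ _<ᴿ_

record _≈ᴿ_ (x y : ℝ) : Set where
  no-eta-equality; pattern
  constructor mk≈
  field
    close : ∀ ε → 0ℚ ℚ.< ε → Eventually λ n → ℚ.∣ seq x n ℚ.- seq y n ∣ ℚ.≤ ε

record _≤ᴿ_ (x y : ℝ) : Set where
  no-eta-equality; pattern
  constructor mk≤
  field
    below : ∀ ε → 0ℚ ℚ.< ε → Eventually λ n → seq x n ℚ.≤ seq y n ℚ.+ ε

record _<ᴿ_ (x y : ℝ) : Set where
  no-eta-equality; pattern
  constructor mk<
  field
    gap       : ℚ
    0<gap     : 0ℚ ℚ.< gap
    gap-bound : Eventually λ n → seq x n ℚ.+ gap ℚ.≤ seq y n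

open _≈ᴿ_ public
open _≤ᴿ_ public
open _<ᴿ_ public

always : ∀ {P} → (∀ n → P n) → Eventually P
always h = 0 , λ n _ → h n

map-ev : ∀ {P Q} → (∀ n → P n → Q n) → Eventually P → Eventually Q
map-ev f (N , h) = N , λ n N≤n → f n (h n N≤n)

zip-ev : ∀ {P Q R} → (∀ n → P n → Q n → R n) → Eventually P → Eventually Q → Eventually R
zip-ev f (M , h) (N , k) = M ℕ.⊔ N , λ n le →
  f n (h n (ℕ.≤-trans (ℕ.m≤m⊔n M N) le)) (k n (ℕ.≤-trans (ℕ.m≤n⊔m M N) le))

≈ᴿ-refl : ∀ {x} → x ≈ᴿ x
≈ᴿ-refl {x} = mk≈ λ ε 0<ε → always λ n →
  subst (ℚ._≤ ε) (sym (∣p-p∣≡0 (seq x n))) (ℚ.<⇒≤ 0<ε)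

≈ᴿ-sym : ∀ {x y} → x ≈ᴿ y → y ≈ᴿ x
≈ᴿ-sym {x} {y} (mk≈ h) = mk≈ λ ε 0<ε →
  map-ev (λ n → subst (ℚ._≤ ε) (∣p-q∣≡∣q-p∣ (seq x n) (seq y n))) (h ε 0<ε)

≈ᴿ-trans : ∀ {x y z} → x ≈ᴿ y → y ≈ᴿ z → x ≈ᴿ z
≈ᴿ-trans {x} {y} {z} (mk≈ h) (mk≈ k) = mk≈ λ ε 0<ε → zip-ev
  (λ n a b → subst₂ ℚ._≤_
    (cong ℚ.∣_∣ (solve 3 (λ x y z → (x :- y) :+ (y :- z) := x :- z) refl (seq x n) (seq y n) (seq z n)))
    (½+½ ε)
    (ℚ.≤-trans (ℚ.∣p+q∣≤∣p∣+∣q∣ (seq x n ℚ.- seq y n) (seq y n ℚ.- seq z n)) (ℚ.+-mono-≤ a b)))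
  (h (½ ℚ.* ε) (0<½* 0<ε)) (k (½ ℚ.* ε) (0<½* 0<ε))
  where open +-*-Solver

≤ᴿ-trans : ∀ {x y z} → x ≤ᴿ y → y ≤ᴿ z → x ≤ᴿ z
≤ᴿ-trans {x} {y} {z} (mk≤ h) (mk≤ k) = mk≤ λ ε 0<ε → zip-ev
  (λ n a b → ℚ.≤-trans a (subst (seq y n ℚ.+ ½ ℚ.* ε ℚ.≤_)
    (trans (ℚ.+-assoc (seq z n) (½ ℚ.* ε) (½ ℚ.* ε)) (cong (seq z n ℚ.+_) (½+½ ε)))
    (ℚ.+-monoˡ-≤ (½ ℚ.* ε) b)))
  (h (½ ℚ.* ε) (0<½* 0<ε)) (k (½ ℚ.* ε) (0<½* 0<ε))

bounded : ∀ x → ∃ λ b → 0ℚ ℚ.< b × Eventually λ n → ℚ.∣ seq x n ∣ ℚ.≤ b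
bounded x with cauchy x 1ℚ (ℚ.positive⁻¹ 1ℚ)
... | N , h = ℚ.∣ seq x N ∣ ℚ.+ 1ℚ
    , ℚ.+-mono-≤-< (ℚ.0≤∣p∣ (seq x N)) (ℚ.positive⁻¹ 1ℚ)
    , N , λ n N≤n → subst (ℚ._≤ ℚ.∣ seq x N ∣ ℚ.+ 1ℚ)
        (cong ℚ.∣_∣ (solve 2 (λ a b → b :+ (a :- b) := a) refl (seq x n) (seq x N)))
        (ℚ.≤-trans (ℚ.∣p+q∣≤∣p∣+∣q∣ (seq x N) (seq x n ℚ.- seq x N))
                   (ℚ.+-monoʳ-≤ ℚ.∣ seq x N ∣ (h n N N≤n ℕ.≤-refl)))
    where open +-*-Solver

fromℚ : ℚ → ℝ
fromℚ p = mkℝ (λ _ → p) λ ε 0<ε → 0 , λ _ _ _ _ →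
  subst (ℚ._≤ ε) (sym (∣p-p∣≡0 p)) (ℚ.<⇒≤ 0<ε)

0ᴿ 1ᴿ : ℝ
0ᴿ = fromℚ 0ℚ
1ᴿ = fromℚ 1ℚ

infixl 6 _+ᴿ_ _-ᴿ_
infixl 7 _*ᴿ_
infix  8 -ᴿ_

_+ᴿ_ : ℝ → ℝ → ℝ
seq    (x +ᴿ y) n = seq x n ℚ.+ seq y n
cauchy (x +ᴿ y) ε 0<ε with cauchy x (½ ℚ.* ε) (0<½* 0<ε) | cauchy y (½ ℚ.* ε) (0<½* 0<ε)
... | M , h | N , k = M ℕ.⊔ N , λ m n le le′ →
  let M≤ : ∀ {k} → M ℕ.⊔ N ℕ.≤ k → M ℕ.≤ k
      M≤ = ℕ.m⊔n≤o⇒m≤o M N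
      N≤ : ∀ {k} → M ℕ.⊔ N ℕ.≤ k → N ℕ.≤ k
      N≤ = ℕ.m⊔n≤o⇒n≤o M N
  in
  subst₂ ℚ._≤_
    (cong ℚ.∣_∣ (solve 4 (λ a b c d → (a :- c) :+ (b :- d) := (a :+ b) :- (c :+ d)) refl
                  (seq x m) (seq y m) (seq x n) (seq y n)))
    (½+½ ε)
    (ℚ.≤-trans (ℚ.∣p+q∣≤∣p∣+∣q∣ (seq x m ℚ.- seq x n) (seq y m ℚ.- seq y n))
               (ℚ.+-mono-≤ (h m n (M≤ le) (M≤ le′)) (k m n (N≤ le) (N≤ le′))))
  where open +-*-Solver

-ᴿ_ : ℝ → ℝ
seq    (-ᴿ x) n = ℚ.- seq x n
cauchy (-ᴿ x) ε 0<ε with cauchy x ε 0<ε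
... | N , h = N , λ m n le le′ → subst (ℚ._≤ ε)
  (cong ℚ.∣_∣ (solve 2 (λ a b → b :- a := (:- a) :- (:- b)) refl (seq x m) (seq x n)))
  (h n m le′ le)
  where open +-*-Solver

_-ᴿ_ : ℝ → ℝ → ℝ
x -ᴿ y = x +ᴿ (-ᴿ y)

_*ᴿ_ : ℝ → ℝ → ℝ
seq    (x *ᴿ y) n = seq x n ℚ.* seq y n
cauchy (x *ᴿ y) ε 0<ε =
  let b , 0<b , B , hb = bounded x
      c , 0<c , C , hc = bounded y
      δ , 0<δ , bδ     = quotient 0<b (0<½* 0<ε)
      η , 0<η , cη     = quotient 0<c (0<½* 0<ε)
      M , hM           = cauchy y δ 0<δ
      N , hN           = cauchy x η 0<η
      B≤ : ∀ {k} → (B ℕ.⊔ C) ℕ.⊔ (M ℕ.⊔ N) ℕ.≤ k → B ℕ.≤ k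
      B≤ le = ℕ.m⊔n≤o⇒m≤o B C (ℕ.m⊔n≤o⇒m≤o (B ℕ.⊔ C) (M ℕ.⊔ N) le)
      C≤ : ∀ {k} → (B ℕ.⊔ C) ℕ.⊔ (M ℕ.⊔ N) ℕ.≤ k → C ℕ.≤ k
      C≤ le = ℕ.m⊔n≤o⇒n≤o B C (ℕ.m⊔n≤o⇒m≤o (B ℕ.⊔ C) (M ℕ.⊔ N) le)
      M≤ : ∀ {k} → (B ℕ.⊔ C) ℕ.⊔ (M ℕ.⊔ N) ℕ.≤ k → M ℕ.≤ k
      M≤ le = ℕ.m⊔n≤o⇒m≤o M N (ℕ.m⊔n≤o⇒n≤o (B ℕ.⊔ C) (M ℕ.⊔ N) le)
      N≤ : ∀ {k} → (B ℕ.⊔ C) ℕ.⊔ (M ℕ.⊔ N) ℕ.≤ k → N ℕ.≤ k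
      N≤ le = ℕ.m⊔n≤o⇒n≤o M N (ℕ.m⊔n≤o⇒n≤o (B ℕ.⊔ C) (M ℕ.⊔ N) le)
  in (B ℕ.⊔ C) ℕ.⊔ (M ℕ.⊔ N) , λ m n le le′ →
    subst (ℚ.∣ seq x m ℚ.* seq y m ℚ.- seq x n ℚ.* seq y n ∣ ℚ.≤_)
      (trans (cong₂ ℚ._+_ bδ cη) (½+½ ε))
      (*-close (seq x m) (seq y m) (seq x n) (seq y n) (ℚ.<⇒≤ 0<b) (ℚ.<⇒≤ 0<c)
        (hb m (B≤ le)) (hc n (C≤ le′)) (hM m n (M≤ le) (M≤ le′)) (hN m n (N≤ le) (N≤ le′)))

-- √x is the square root of max(x,0).
√_ : ℝ → ℝ
seq    (√ x) n = lower (seq x n ℚ.⊔ 0ℚ) n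
cauchy (√ x) ε 0<ε =
  let b , 0<b , B , hb = bounded x
      M , hM           = cauchy x ((½ ℚ.* ε) ℚ.* (½ ℚ.* ε)) (0<* (0<½* 0<ε) (0<½* 0<ε))
      N , hN           = width-⊔0-small 0<b (0<½* 0<ε)
      B≤ : ∀ {k} → B ℕ.⊔ (M ℕ.⊔ N) ℕ.≤ k → B ℕ.≤ k
      B≤ = ℕ.m⊔n≤o⇒m≤o B (M ℕ.⊔ N)
      M≤ : ∀ {k} → B ℕ.⊔ (M ℕ.⊔ N) ℕ.≤ k → M ℕ.≤ k
      M≤ le = ℕ.m⊔n≤o⇒m≤o M N (ℕ.m⊔n≤o⇒n≤o B (M ℕ.⊔ N) le)
      N≤ : ∀ {k} → B ℕ.⊔ (M ℕ.⊔ N) ℕ.≤ k → N ℕ.≤ k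
      N≤ le = ℕ.m⊔n≤o⇒n≤o M N (ℕ.m⊔n≤o⇒n≤o B (M ℕ.⊔ N) le)
      close : ∀ m n → B ℕ.⊔ (M ℕ.⊔ N) ℕ.≤ m → B ℕ.⊔ (M ℕ.⊔ N) ℕ.≤ n →
        lower (seq x m ℚ.⊔ 0ℚ) m ℚ.≤ lower (seq x n ℚ.⊔ 0ℚ) n ℚ.+ ε
      close m n le le′ = lower-⊔0-close (seq x m) (seq x n) m n 0<ε
        (∣p-q∣≤⇒p≤q+ (hM m n (M≤ le) (M≤ le′)))
        (hN n (N≤ le′) (seq x n) (hb n (B≤ le′)))
  in B ℕ.⊔ (M ℕ.⊔ N) , λ m n le le′ → p≤q+⇒∣p-q∣≤ (close m n le le′) (close n m le′ le)

√-mono-ev : ∀ x y → Eventually (λ n → seq x n ℚ.≤ seq y n) → √ x ≤ᴿ √ y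
√-mono-ev x y h = mk≤ λ ε 0<ε →
  let b , 0<b , hb = bounded y in
  zip-ev (λ n f h → f h)
    (zip-ev (λ n x≤y w h → lower-⊔0-close (seq x n) (seq y n) n n 0<ε
               (ℚ.≤-trans x≤y (p≤p+ (seq y n) (0≤p² (½ ℚ.* ε)))) (w (seq y n) h))
            h (width-⊔0-small 0<b (0<½* 0<ε)))
    hb

record ℂ : Set where
  constructor _+i_
  field
    re im : ℝ

open ℂ public

infix 4 _≈ᶜ_

record _≈ᶜ_ (z w : ℂ) : Set where
  constructor _,_
  field
    re-≈ : re z ≈ᴿ re w
    im-≈ : im z ≈ᴿ im w

0ᶜ 1ᶜ : ℂ
0ᶜ = 0ᴿ +i 0ᴿ
1ᶜ = 1ᴿ +i 0ᴿ

infixl 6 _+ᶜ_ _-ᶜ_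
infixl 7 _*ᶜ_

_+ᶜ_ _-ᶜ_ _*ᶜ_ : ℂ → ℂ → ℂ
z +ᶜ w = (re z +ᴿ re w) +i (im z +ᴿ im w)
z -ᶜ w = (re z -ᴿ re w) +i (im z -ᴿ im w)
z *ᶜ w = (re z *ᴿ re w -ᴿ im z *ᴿ im w) +i (re z *ᴿ im w +ᴿ im z *ᴿ re w)

∣_∣² : ℂ → ℝ
∣ z ∣² = re z *ᴿ re z +ᴿ im z *ᴿ im z

∣_∣ : ℂ → ℝ
∣ z ∣ = √ ∣ z ∣²

ℂ-setoid : Setoid 0ℓ 0ℓ
ℂ-setoid = record
  { Carrier = ℂ
  ; _≈_ = _≈ᶜ_
  ; isEquivalence = record
    { refl  = ≈ᴿ-refl , ≈ᴿ-refl
    ; sym   = λ (h , k) → ≈ᴿ-sym h , ≈ᴿ-sym k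
    ; trans = λ (h , k) (h′ , k′) → ≈ᴿ-trans h h′ , ≈ᴿ-trans k k′
    }
  }

ℂ-rawSemiring : RawSemiring 0ℓ 0ℓ
ℂ-rawSemiring = record
  { Carrier = ℂ ; _≈_ = _≈ᶜ_ ; _+_ = _+ᶜ_ ; _*_ = _*ᶜ_ ; 0# = 0ᶜ ; 1# = 1ᶜ }

ℝ-+-rawMonoid : RawMonoid 0ℓ 0ℓ
ℝ-+-rawMonoid = record { Carrier = ℝ ; _≈_ = _≈ᴿ_ ; _∙_ = _+ᴿ_ ; ε = 0ᴿ }

open RawSemiringDefs ℂ-rawSemiring public using (_^_)

module Sums (M : RawMonoid 0ℓ 0ℓ) where

  open RawMonoid M
  open RawMonoidDefs M public using (sum)

  -- sumFrom k v = v k + ⋯ + v (n - 1), entries being numbered from 0.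
  sumFrom : ∀ {n} → ℕ → Vector Carrier n → Carrier
  sumFrom         zero    v = sum v
  sumFrom {zero}  (suc k) v = ε
  sumFrom {suc n} (suc k) v = sumFrom k (tail v)

open Sums (RawSemiring.+-rawMonoid ℂ-rawSemiring) public
  renaming (sum to sumᶜ; sumFrom to sumFromᶜ)
open Sums ℝ-+-rawMonoid public
  renaming (sum to sumᴿ; sumFrom to sumFromᴿ)

record Point (r : ℝ) : Set where
  no-eta-equality
  constructor _,_
  field
    point  : ℂ
    inDisc : ∣ point ∣ ≤ᴿ r

open Point public

Disc : ℝ → Setoid 0ℓ 0ℓ
Disc r = record
  { Carrier = Point r
  ; _≈_ = λ z w → point z ≈ᶜ point w
  ; isEquivalence = record
    { refl = S.refl ; sym = S.sym ; trans = S.trans }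
  }
  where module S = Setoid ℂ-setoid

Fun : ℝ → Set
Fun r = Disc r ⟶ₛ ℂ-setoid

Continuous : ∀ {r} → Fun r → Set
Continuous {r} f = ∀ z ε → 0ᴿ <ᴿ ε → ∃ λ δ → 0ᴿ <ᴿ δ ×
  (∀ w → ∣ point w -ᶜ point z ∣ <ᴿ δ → ∣ (f ⟨$⟩ w) -ᶜ (f ⟨$⟩ z) ∣ <ᴿ ε)

∣0∣≤ : ∀ {r} → 0ᴿ <ᴿ r → ∣ 0ᶜ ∣ ≤ᴿ r
∣0∣≤ (mk< δ 0<δ h) = mk≤ λ ε 0<ε → map-ev (λ n → lower-0-≤ n 0<δ 0<ε) h

centre : ∀ {r} → 0ᴿ <ᴿ r → Point r
point  (centre 0<r) = 0ᶜ
inDisc (centre 0<r) = ∣0∣≤ 0<r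

seq-∣zw∣² : ∀ z w n → seq ∣ z *ᶜ w ∣² n ≡ seq ∣ z ∣² n ℚ.* seq ∣ w ∣² n
seq-∣zw∣² z w n = two-squares (seq (re z) n) (seq (im z) n) (seq (re w) n) (seq (im w) n)

0≤seq-∣z∣² : ∀ z n → 0ℚ ℚ.≤ seq ∣ z ∣² n
0≤seq-∣z∣² z n = 0≤p²+q² (seq (re z) n) (seq (im z) n)

∣z∣<1⇒∣z∣²≤1 : ∀ z → ∣ z ∣ <ᴿ 1ᴿ → Eventually λ n → seq ∣ z ∣² n ℚ.≤ 1ℚ
∣z∣<1⇒∣z∣²≤1 z (mk< ε 0<ε h) =
  let b , 0<b , hb = bounded ∣ z ∣² in
  zip-ev (λ n f h → f h)
    (zip-ev (λ n l w h → lower-⊔0-≤1 (seq ∣ z ∣² n) n l (w (seq ∣ z ∣² n) h))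
            h (width-⊔0-small 0<b 0<ε))
    hb

module _ (q : ℂ) (∣q∣<1 : ∣ q ∣ <ᴿ 1ᴿ) where

  ∣qᵏ∣²≤1 : ∀ k → Eventually λ n → seq ∣ q ^ k ∣² n ℚ.≤ 1ℚ
  ∣qᵏ∣²≤1 zero    = always λ _ → ℚ.≤-refl
  ∣qᵏ∣²≤1 (suc k) = zip-ev
    (λ n h h′ → subst (ℚ._≤ 1ℚ) (sym (seq-∣zw∣² q (q ^ k) n))
      (ℚ.≤-trans (*-≤1 (seq ∣ q ∣² n) (seq ∣ q ^ k ∣² n) (0≤seq-∣z∣² q n) h′) h))
    (∣z∣<1⇒∣z∣²≤1 q ∣q∣<1) (∣qᵏ∣²≤1 k)

  ∣zqᵏ∣≤∣z∣ : ∀ z k → ∣ z *ᶜ q ^ k ∣ ≤ᴿ ∣ z ∣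
  ∣zqᵏ∣≤∣z∣ z k = √-mono-ev ∣ z *ᶜ q ^ k ∣² ∣ z ∣² (map-ev
    (λ n h → subst (ℚ._≤ seq ∣ z ∣² n) (sym (seq-∣zw∣² z (q ^ k) n))
      (*-≤1 (seq ∣ z ∣² n) (seq ∣ q ^ k ∣² n) (0≤seq-∣z∣² z n) h))
    (∣qᵏ∣²≤1 k))

  _·q^_ : ∀ {r} → Point r → ℕ → Point r
  point  (z ·q^ k) = point z *ᶜ q ^ k
  inDisc (z ·q^ k) = ≤ᴿ-trans (∣zqᵏ∣≤∣z∣ (point z) k) (inDisc z)

  -- f(z) = a₁(z) f(zq) + ⋯ + a_d(z) f(zq^d); the entry  a i  is a_{i+1}.
  SatisfiesRecurrence : ∀ {r d} → Vector (Fun r) d → Fun r → Set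
  SatisfiesRecurrence a f = ∀ z →
    (f ⟨$⟩ z) ≈ᶜ sumᶜ (λ i → (a i ⟨$⟩ z) *ᶜ (f ⟨$⟩ (z ·q^ suc (toℕ i))))

{-# OPTIONS --safe #-}

-- Put h = g - f and h_m = h(z q^m), which tends to h(0) = 0 by continuity, and let
-- c_i = w_{i+1} + ⋯ + w_d, so c_0 = 1.  Summation by parts turns the recurrence into
-- P_m = P_{m+1} + e_m  for  P_m = c_0 h_m + c_1 h_{m+1} + ⋯ + c_{d-1} h_{m+d-1},
-- where e_m = Σ (a_i(z q^m) - w_i) h_{m+i} is O(∣q∣^m) times a bound for the later values of h.
-- Since κ = ∣c_1∣ + ⋯ + ∣c_{d-1}∣ < 1, a bound on P_m gives one on h_m = P_m - Σ_{i≥1} c_i h_{m+i}.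
-- If ∣h_m∣ ≤ δ for all m ≥ N, a finite descent from N carries  ∣h_m∣ ≤ Kδ  with K = 4 / (1 - κ)
-- down to an index n₀ depending on neither δ nor N.  Hence h_m = 0 for m ≥ n₀, and the recurrence
-- itself then gives h_m = 0 for smaller m.
module Submission where

open import Defs
open import Algebra.Bundles using (CommutativeRing)
import Algebra.Definitions.RawSemiring as RawSemiringDefs
import Algebra.Properties.Ring as RingProperties
import Algebra.Properties.Semiring.Exp as SemiringExp
import Algebra.Properties.Semiring.Sum as SemiringSum
open import Algebra.Structures using (IsCommutativeRing)
open import Data.Fin.Base as Fin using (Fin; toℕ)
open import Data.Nat.Base as ℕ using (ℕ; zero; suc; _≤_)
import Data.Nat.Properties as ℕ
open import Data.Product.Base using (∃; _×_; _,_; proj₁; proj₂)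
open import Data.Rational.Base as ℚ using (ℚ; 0ℚ; 1ℚ; ½)
import Data.Rational.Properties as ℚ
open import Data.Rational.Solver using (module +-*-Solver)
open import Data.Sum.Base using (inj₁; inj₂)
open import Data.Vec.Functional using (Vector; tail)
open import Function.Base using (_∘_)
open import Function.Bundles using (Func; _⟨$⟩_)
open import Level using (0ℓ)
open import Relation.Binary.Bundles using (Setoid)
open import Relation.Binary.PropositionalEquality
  using (_≡_; refl; sym; trans; cong; cong₂; subst; subst₂)
import Relation.Binary.Reasoning.Setoid as SetoidReasoning
open import Relation.Nullary.Negation using (¬_)

open Rational
open +-*-Solver
open RawSemiringDefs ℚ.+-*-rawSemiring using () renaming (_^_ to _^ℚ_)

-- The commutative ring of complex numbers.

≡⇒≈ᴿ : ∀ {x y} → (∀ n → seq x n ≡ seq y n) → x ≈ᴿ y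
≡⇒≈ᴿ {x} {y} h = mk≈ λ ε 0<ε → always λ n →
  subst (λ t → ℚ.∣ seq x n ℚ.- t ∣ ℚ.≤ ε) (h n)
    (subst (ℚ._≤ ε) (sym (∣p-p∣≡0 (seq x n))) (ℚ.<⇒≤ 0<ε))

+ᴿ-cong : ∀ {x x′ y y′} → x ≈ᴿ x′ → y ≈ᴿ y′ → x +ᴿ y ≈ᴿ x′ +ᴿ y′
+ᴿ-cong {x} {x′} {y} {y′} (mk≈ h) (mk≈ k) = mk≈ λ ε 0<ε → zip-ev
  (λ n a b → subst₂ ℚ._≤_
    (cong ℚ.∣_∣ (solve 4 (λ a b c d → (a :- c) :+ (b :- d) := (a :+ b) :- (c :+ d)) refl
                  (seq x n) (seq y n) (seq x′ n) (seq y′ n)))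
    (½+½ ε)
    (ℚ.≤-trans (ℚ.∣p+q∣≤∣p∣+∣q∣ (seq x n ℚ.- seq x′ n) (seq y n ℚ.- seq y′ n)) (ℚ.+-mono-≤ a b)))
  (h (½ ℚ.* ε) (0<½* 0<ε)) (k (½ ℚ.* ε) (0<½* 0<ε))

-ᴿ-cong : ∀ {x y} → x ≈ᴿ y → -ᴿ x ≈ᴿ -ᴿ y
-ᴿ-cong {x} {y} h = mk≈ λ ε 0<ε → map-ev
  (λ n → subst (ℚ._≤ ε)
    (cong ℚ.∣_∣ (solve 2 (λ a b → b :- a := (:- a) :- (:- b)) refl (seq x n) (seq y n))))
  (close (≈ᴿ-sym h) ε 0<ε)

-- The splitting xy - x′y′ = x(y - y′) + y′(x - x′) needs bounds for `x` and `y′` only; each summand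
-- receives ε/2.
*ᴿ-cong : ∀ {x x′ y y′} → x ≈ᴿ x′ → y ≈ᴿ y′ → x *ᴿ y ≈ᴿ x′ *ᴿ y′
*ᴿ-cong {x} {x′} {y} {y′} (mk≈ h) (mk≈ k) = mk≈ λ ε 0<ε →
  let b , 0<b , hb = bounded x
      c , 0<c , hc = bounded y′
      δ , 0<δ , bδ = quotient 0<b (0<½* 0<ε)
      η , 0<η , cη = quotient 0<c (0<½* 0<ε)
  in zip-ev (λ n f x-x′ → f x-x′)
    (zip-ev (λ n f y-y′ → f y-y′)
      (zip-ev (λ n x≤b y′≤c y-y′ x-x′ →
          subst (ℚ.∣ seq x n ℚ.* seq y n ℚ.- seq x′ n ℚ.* seq y′ n ∣ ℚ.≤_)
            (trans (cong₂ ℚ._+_ bδ cη) (½+½ ε))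
            (*-close (seq x n) (seq y n) (seq x′ n) (seq y′ n) (ℚ.<⇒≤ 0<b) (ℚ.<⇒≤ 0<c)
              x≤b y′≤c y-y′ x-x′))
        hb hc)
      (k δ 0<δ))
    (h η 0<η)

infix 8 -ᶜ_

-ᶜ_ : ℂ → ℂ
-ᶜ z = (-ᴿ re z) +i (-ᴿ im z)

-- The ring operations act termwise on sequences, so each ring law reduces to a rational polynomial
-- identity at every index.
≡⇒≈ᶜ : ∀ {z w} → (∀ n → seq (re z) n ≡ seq (re w) n) → (∀ n → seq (im z) n ≡ seq (im w) n) → z ≈ᶜ w
≡⇒≈ᶜ h k = ≡⇒≈ᴿ h , ≡⇒≈ᴿ k

*ᶜ-assoc : ∀ z w v → (z *ᶜ w) *ᶜ v ≈ᶜ z *ᶜ (w *ᶜ v)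
*ᶜ-assoc z w v = ≡⇒≈ᶜ
  (λ n → solve 6 (λ a b c d e f →
      (a :* c :+ :- (b :* d)) :* e :+ :- ((a :* d :+ b :* c) :* f)
        := a :* (c :* e :+ :- (d :* f)) :+ :- (b :* (c :* f :+ d :* e))) refl
    (seq (re z) n) (seq (im z) n) (seq (re w) n) (seq (im w) n) (seq (re v) n) (seq (im v) n))
  (λ n → solve 6 (λ a b c d e f →
      (a :* c :+ :- (b :* d)) :* f :+ (a :* d :+ b :* c) :* e
        := a :* (c :* f :+ d :* e) :+ b :* (c :* e :+ :- (d :* f))) refl
    (seq (re z) n) (seq (im z) n) (seq (re w) n) (seq (im w) n) (seq (re v) n) (seq (im v) n))

*ᶜ-comm : ∀ z w → z *ᶜ w ≈ᶜ w *ᶜ z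
*ᶜ-comm z w = ≡⇒≈ᶜ
  (λ n → solve 4 (λ a b c d → a :* c :+ :- (b :* d) := c :* a :+ :- (d :* b)) refl
    (seq (re z) n) (seq (im z) n) (seq (re w) n) (seq (im w) n))
  (λ n → solve 4 (λ a b c d → a :* d :+ b :* c := c :* b :+ d :* a) refl
    (seq (re z) n) (seq (im z) n) (seq (re w) n) (seq (im w) n))

*ᶜ-identityˡ : ∀ z → 1ᶜ *ᶜ z ≈ᶜ z
*ᶜ-identityˡ z = ≡⇒≈ᶜ
  (λ n → solve 2 (λ a b → con 1ℚ :* a :+ :- (con 0ℚ :* b) := a) refl (seq (re z) n) (seq (im z) n))
  (λ n → solve 2 (λ a b → con 1ℚ :* b :+ con 0ℚ :* a := b) refl (seq (re z) n) (seq (im z) n))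

*ᶜ-distribʳ : ∀ v z w → (z +ᶜ w) *ᶜ v ≈ᶜ z *ᶜ v +ᶜ w *ᶜ v
*ᶜ-distribʳ v z w = ≡⇒≈ᶜ
  (λ n → solve 6 (λ a b c d e f →
      (a :+ c) :* e :+ :- ((b :+ d) :* f) := (a :* e :+ :- (b :* f)) :+ (c :* e :+ :- (d :* f))) refl
    (seq (re z) n) (seq (im z) n) (seq (re w) n) (seq (im w) n) (seq (re v) n) (seq (im v) n))
  (λ n → solve 6 (λ a b c d e f →
      (a :+ c) :* f :+ (b :+ d) :* e := (a :* f :+ b :* e) :+ (c :* f :+ d :* e)) refl
    (seq (re z) n) (seq (im z) n) (seq (re w) n) (seq (im w) n) (seq (re v) n) (seq (im v) n))

*ᶜ-cong : ∀ {z z′ w w′} → z ≈ᶜ z′ → w ≈ᶜ w′ → z *ᶜ w ≈ᶜ z′ *ᶜ w′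
*ᶜ-cong (h , k) (h′ , k′) =
  +ᴿ-cong (*ᴿ-cong h h′) (-ᴿ-cong (*ᴿ-cong k k′)) , +ᴿ-cong (*ᴿ-cong h k′) (*ᴿ-cong k h′)

+ᶜ-cong : ∀ {z z′ w w′} → z ≈ᶜ z′ → w ≈ᶜ w′ → z +ᶜ w ≈ᶜ z′ +ᶜ w′
+ᶜ-cong (h , k) (h′ , k′) = +ᴿ-cong h h′ , +ᴿ-cong k k′

+ᶜ-comm : ∀ z w → z +ᶜ w ≈ᶜ w +ᶜ z
+ᶜ-comm z w = ≡⇒≈ᶜ (λ n → ℚ.+-comm (seq (re z) n) (seq (re w) n))
                   (λ n → ℚ.+-comm (seq (im z) n) (seq (im w) n))

+ᶜ-identityˡ : ∀ z → 0ᶜ +ᶜ z ≈ᶜ z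
+ᶜ-identityˡ z = ≡⇒≈ᶜ (λ n → ℚ.+-identityˡ (seq (re z) n)) (λ n → ℚ.+-identityˡ (seq (im z) n))

-ᶜ-inverseˡ : ∀ z → -ᶜ z +ᶜ z ≈ᶜ 0ᶜ
-ᶜ-inverseˡ z = ≡⇒≈ᶜ (λ n → ℚ.+-inverseˡ (seq (re z) n)) (λ n → ℚ.+-inverseˡ (seq (im z) n))

private module S = Setoid ℂ-setoid

ℂ-isCommutativeRing : IsCommutativeRing _≈ᶜ_ _+ᶜ_ _*ᶜ_ -ᶜ_ 0ᶜ 1ᶜ
ℂ-isCommutativeRing = record
  { isRing = record
    { +-isAbelianGroup = record
      { isGroup = record
        { isMonoid = record
          { isSemigroup = record
            { isMagma = record { isEquivalence = S.isEquivalence ; ∙-cong = +ᶜ-cong }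
            ; assoc = λ z w v → ≡⇒≈ᶜ
                (λ n → ℚ.+-assoc (seq (re z) n) (seq (re w) n) (seq (re v) n))
                (λ n → ℚ.+-assoc (seq (im z) n) (seq (im w) n) (seq (im v) n))
            }
          ; identity = +ᶜ-identityˡ , λ z → S.trans (+ᶜ-comm z 0ᶜ) (+ᶜ-identityˡ z)
          }
        ; inverse = -ᶜ-inverseˡ , λ z → S.trans (+ᶜ-comm z (-ᶜ z)) (-ᶜ-inverseˡ z)
        ; ⁻¹-cong = λ (h , k) → -ᴿ-cong h , -ᴿ-cong k
        }
      ; comm = +ᶜ-comm
      }
    ; *-cong = *ᶜ-cong
    ; *-assoc = *ᶜ-assoc
    ; *-identity = *ᶜ-identityˡ , λ z → S.trans (*ᶜ-comm z 1ᶜ) (*ᶜ-identityˡ z)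
    ; distrib = (λ v z w → S.trans (*ᶜ-comm v (z +ᶜ w)) (S.trans (*ᶜ-distribʳ v z w)
                  (+ᶜ-cong (*ᶜ-comm z v) (*ᶜ-comm w v))))
              , *ᶜ-distribʳ
    }
  ; *-comm = *ᶜ-comm
  }

ℂ-commutativeRing : CommutativeRing 0ℓ 0ℓ
ℂ-commutativeRing = record { isCommutativeRing = ℂ-isCommutativeRing }

-- Rational bounds for the modulus.

sq-mono-≤ : ∀ {p q} → 0ℚ ℚ.≤ p → p ℚ.≤ q → p ℚ.* p ℚ.≤ q ℚ.* q
sq-mono-≤ {p} {q} 0≤p p≤q = *-mono-≤ {p} {q} {p} {q} 0≤p (ℚ.≤-trans 0≤p p≤q) p≤q p≤q

-- Expanding (s + t)² reduces the claim to ac + bd ≤ st, which is the Cauchy-Schwarz inequality.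
minkowski : ∀ a b c d {s t} → 0ℚ ℚ.≤ s → 0ℚ ℚ.≤ t →
  a ℚ.* a ℚ.+ b ℚ.* b ℚ.≤ s ℚ.* s → c ℚ.* c ℚ.+ d ℚ.* d ℚ.≤ t ℚ.* t →
  (a ℚ.+ c) ℚ.* (a ℚ.+ c) ℚ.+ (b ℚ.+ d) ℚ.* (b ℚ.+ d) ℚ.≤ (s ℚ.+ t) ℚ.* (s ℚ.+ t)
minkowski a b c d {s} {t} 0≤s 0≤t h k =
  by ((s ℚ.* s ℚ.- A) ℚ.+ (t ℚ.* t ℚ.- C) ℚ.+ (s ℚ.* t ℚ.- X ℚ.+ (s ℚ.* t ℚ.- X)))
     (solve 6 (λ a b c d s t →
        (s :+ t) :* (s :+ t) :- ((a :+ c) :* (a :+ c) :+ (b :+ d) :* (b :+ d))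
          := (s :* s :- (a :* a :+ b :* b)) :+ (t :* t :- (c :* c :+ d :* d))
             :+ (s :* t :- (a :* c :+ b :* d) :+ (s :* t :- (a :* c :+ b :* d)))) refl a b c d s t)
     (0≤+ {(s ℚ.* s ℚ.- A) ℚ.+ (t ℚ.* t ℚ.- C)}
       (0≤+ {s ℚ.* s ℚ.- A} (≤⇒0≤ h) (≤⇒0≤ k))
       (0≤+ {s ℚ.* t ℚ.- X} (≤⇒0≤ cauchy-schwarz) (≤⇒0≤ cauchy-schwarz)))
  where
  A = a ℚ.* a ℚ.+ b ℚ.* b
  C = c ℚ.* c ℚ.+ d ℚ.* d
  X = a ℚ.* c ℚ.+ b ℚ.* d
  Y = a ℚ.* d ℚ.- b ℚ.* c
  cauchy-schwarz : X ℚ.≤ s ℚ.* t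
  cauchy-schwarz = sq-cancel-≤ (0≤* 0≤s 0≤t) (ℚ.≤-trans
    -- Lagrange's identity: AC - X² = Y².
    (by (Y ℚ.* Y)
        (solve 4 (λ a b c d →
          (a :* a :+ b :* b) :* (c :* c :+ d :* d) :- (a :* c :+ b :* d) :* (a :* c :+ b :* d)
            := (a :* d :- b :* c) :* (a :* d :- b :* c)) refl a b c d)
        (0≤p² Y))
    (subst (A ℚ.* C ℚ.≤_)
      (solve 2 (λ s t → (s :* s) :* (t :* t) := (s :* t) :* (s :* t)) refl s t)
      (*-mono-≤ {A} {s ℚ.* s} {C} {t ℚ.* t} (0≤p²+q² a b) (0≤p² t) h k)))

-- ∣ z ∣ ≤ b for a rational b, read off the squares so that no root enters.
infix 4 _≼_

record _≼_ (z : ℂ) (b : ℚ) : Set where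
  no-eta-equality; pattern
  constructor mk≼
  field
    0≤bound : 0ℚ ℚ.≤ b
    sq≤     : ∀ ε → 0ℚ ℚ.< ε → Eventually λ n → seq ∣ z ∣² n ℚ.≤ (b ℚ.+ ε) ℚ.* (b ℚ.+ ε)

open _≼_

ev-≤⇒≼ : ∀ {z b} → 0ℚ ℚ.≤ b → Eventually (λ n → seq ∣ z ∣² n ℚ.≤ b ℚ.* b) → z ≼ b
ev-≤⇒≼ {z} {b} 0≤b h = mk≼ 0≤b λ ε 0<ε →
  map-ev (λ n le → ℚ.≤-trans le (sq-mono-≤ {b} 0≤b (p≤p+ b (ℚ.<⇒≤ 0<ε)))) h

≼-weaken : ∀ {z b c} → b ℚ.≤ c → z ≼ b → z ≼ c
≼-weaken {z} {b} {c} b≤c (mk≼ 0≤b h) = mk≼ (ℚ.≤-trans 0≤b b≤c) λ ε 0<ε →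
  map-ev (λ n le → ℚ.≤-trans le (sq-mono-≤ {b ℚ.+ ε} (0≤+ {b} 0≤b (ℚ.<⇒≤ 0<ε)) (ℚ.+-monoˡ-≤ ε b≤c)))
    (h ε 0<ε)

≼-+ : ∀ {z w b c} → z ≼ b → w ≼ c → z +ᶜ w ≼ b ℚ.+ c
≼-+ {z} {w} {b} {c} (mk≼ 0≤b h) (mk≼ 0≤c k) = mk≼ (0≤+ {b} 0≤b 0≤c) λ ε 0<ε → zip-ev
  (λ n le le′ → subst (λ t → seq ∣ z +ᶜ w ∣² n ℚ.≤ t ℚ.* t)
    (solve 3 (λ b c ε → (b :+ con ½ :* ε) :+ (c :+ con ½ :* ε) := b :+ c :+ ε) refl b c ε)
    (minkowski (seq (re z) n) (seq (im z) n) (seq (re w) n) (seq (im w) n)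
      (0≤+ {b} 0≤b (ℚ.<⇒≤ (0<½* 0<ε))) (0≤+ {c} 0≤c (ℚ.<⇒≤ (0<½* 0<ε))) le le′))
  (h (½ ℚ.* ε) (0<½* 0<ε)) (k (½ ℚ.* ε) (0<½* 0<ε))

≼-* : ∀ {z w b c} → z ≼ b → w ≼ c → z *ᶜ w ≼ b ℚ.* c
≼-* {z} {w} {b} {c} (mk≼ 0≤b h) (mk≼ 0≤c k) = mk≼ (0≤* {b} 0≤b 0≤c) λ ε 0<ε →
  -- With δ = ε / m, the summand ε of m gives δ ≤ 1, and then bc + ε - (b + δ)(c + δ) = δ(1 - δ + ε)
  -- ≥ 0.
  let m = b ℚ.+ c ℚ.+ 1ℚ ℚ.+ ε
      0≤b+c = 0≤+ {b} 0≤b 0≤c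
      0≤1 = ℚ.nonNegative⁻¹ 1ℚ
      0<m : 0ℚ ℚ.< m
      0<m = ℚ.+-mono-≤-< {0ℚ} {b ℚ.+ c ℚ.+ 1ℚ} (0≤+ {b ℚ.+ c} 0≤b+c 0≤1) 0<ε
      δ , 0<δ , mδ = quotient 0<m 0<ε
      0≤δ = ℚ.<⇒≤ 0<δ
      0≤b+δ = 0≤+ {b} 0≤b 0≤δ
      0≤c+δ = 0≤+ {c} 0≤c 0≤δ
      δ≤1 : δ ℚ.≤ 1ℚ
      δ≤1 = ℚ.*-cancelˡ-≤-pos m {{ℚ.positive 0<m}}
        (by (b ℚ.+ c ℚ.+ 1ℚ)
            (trans (cong (λ t → m ℚ.* 1ℚ ℚ.- t) mδ)
              (solve 3 (λ b c ε → (b :+ c :+ con 1ℚ :+ ε) :* con 1ℚ :- ε := b :+ c :+ con 1ℚ) refl b c ε))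
            (0≤+ {b ℚ.+ c} 0≤b+c 0≤1))
      bound : (b ℚ.+ δ) ℚ.* (c ℚ.+ δ) ℚ.≤ b ℚ.* c ℚ.+ ε
      bound = by (δ ℚ.* ((1ℚ ℚ.- δ) ℚ.+ ε))
        (trans (cong (λ t → b ℚ.* c ℚ.+ t ℚ.- (b ℚ.+ δ) ℚ.* (c ℚ.+ δ)) (sym mδ))
          (solve 4 (λ b c δ ε → b :* c :+ (b :+ c :+ con 1ℚ :+ ε) :* δ :- (b :+ δ) :* (c :+ δ)
                      := δ :* ((con 1ℚ :- δ) :+ ε)) refl b c δ ε))
        (0≤* 0≤δ (0≤+ {1ℚ ℚ.- δ} (≤⇒0≤ δ≤1) (ℚ.<⇒≤ 0<ε)))
  in zip-ev
    (λ n le le′ → subst (ℚ._≤ (b ℚ.* c ℚ.+ ε) ℚ.* (b ℚ.* c ℚ.+ ε)) (sym (seq-∣zw∣² z w n))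
      (ℚ.≤-trans
        (*-mono-≤ {seq ∣ z ∣² n} {(b ℚ.+ δ) ℚ.* (b ℚ.+ δ)} {seq ∣ w ∣² n} {(c ℚ.+ δ) ℚ.* (c ℚ.+ δ)}
          (0≤seq-∣z∣² z n) (0≤p² (c ℚ.+ δ)) le le′)
        (subst (ℚ._≤ (b ℚ.* c ℚ.+ ε) ℚ.* (b ℚ.* c ℚ.+ ε))
          (solve 2 (λ s t → (s :* t) :* (s :* t) := (s :* s) :* (t :* t)) refl (b ℚ.+ δ) (c ℚ.+ δ))
          (sq-mono-≤ {(b ℚ.+ δ) ℚ.* (c ℚ.+ δ)} (0≤* 0≤b+δ 0≤c+δ) bound))))
    (h δ 0<δ) (k δ 0<δ)

≼-neg : ∀ {z b} → z ≼ b → -ᶜ z ≼ b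
≼-neg {z} {b} (mk≼ 0≤b h) = mk≼ 0≤b λ ε 0<ε → map-ev
  (λ n → subst (ℚ._≤ (b ℚ.+ ε) ℚ.* (b ℚ.+ ε))
    (solve 2 (λ a b → a :* a :+ b :* b := (:- a) :* (:- a) :+ (:- b) :* (:- b)) refl (seq (re z) n) (seq (im z) n)))
  (h ε 0<ε)

0≼ : ∀ {b} → 0ℚ ℚ.≤ b → 0ᶜ ≼ b
0≼ {b} 0≤b = ev-≤⇒≼ {0ᶜ} 0≤b (always λ _ → 0≤p² b)

∣p∣≤⇒p²≤ : ∀ {p e} → ℚ.∣ p ∣ ℚ.≤ e → p ℚ.* p ℚ.≤ e ℚ.* e
∣p∣≤⇒p²≤ {p} {e} h = ℚ.≤-trans (p≤∣p∣ (p ℚ.* p))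
  (∣p*q∣≤ p p (ℚ.≤-trans (ℚ.0≤∣p∣ p) h) h h)

-- Half of the slack in `sq≤` absorbs w - z: its components are eventually at most η = ε/4, and η² +
-- η² ≤ (ε/2)².
≼-resp-≈ : ∀ {z w b} → z ≈ᶜ w → z ≼ b → w ≼ b
≼-resp-≈ {z} {w} {b} (z≈w-re , z≈w-im) (mk≼ 0≤b h) = mk≼ 0≤b λ ε 0<ε →
  let η = ½ ℚ.* (½ ℚ.* ε)
      0<½ε = 0<½* 0<ε
      0<η = 0<½* 0<½ε
  in zip-ev
    (λ n f le → f le)
    (zip-ev
      (λ n x≤ y≤ le → subst₂ (λ s t → s ℚ.≤ t ℚ.* t)
        (solve 4 (λ a b c d →
            (a :+ (c :- a)) :* (a :+ (c :- a)) :+ (b :+ (d :- b)) :* (b :+ (d :- b))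
              := c :* c :+ d :* d) refl
          (seq (re z) n) (seq (im z) n) (seq (re w) n) (seq (im w) n))
        (solve 2 (λ b ε → (b :+ con ½ :* ε) :+ con ½ :* ε := b :+ ε) refl b ε)
        (minkowski (seq (re z) n) (seq (im z) n)
          (seq (re w) n ℚ.- seq (re z) n) (seq (im w) n ℚ.- seq (im z) n)
          (0≤+ {b} 0≤b (ℚ.<⇒≤ 0<½ε)) (ℚ.<⇒≤ 0<½ε) le
          (ℚ.≤-trans (ℚ.+-mono-≤ (∣p∣≤⇒p²≤ x≤) (∣p∣≤⇒p²≤ y≤))
            (by (η ℚ.* η ℚ.+ η ℚ.* η)
              (trans (cong (λ t → t ℚ.* t ℚ.- (η ℚ.* η ℚ.+ η ℚ.* η)) (sym (½+½ (½ ℚ.* ε))))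
                (solve 1 (λ η → (η :+ η) :* (η :+ η) :- (η :* η :+ η :* η) := η :* η :+ η :* η) refl η))
              (0≤p²+q² η η)))))
      (close (≈ᴿ-sym z≈w-re) η 0<η) (close (≈ᴿ-sym z≈w-im) η 0<η))
    (h (½ ℚ.* ε) 0<½ε)

≼⇒≈0 : ∀ {z} → (∀ ε → 0ℚ ℚ.< ε → z ≼ ε) → z ≈ᶜ 0ᶜ
≼⇒≈0 {z} h =
    mk≈ (λ ε 0<ε → map-ev
      (λ n → component≤ 0<ε (seq (re z) n) (0≤p² (seq (im z) n)))
      (sq ε 0<ε))
  , mk≈ (λ ε 0<ε → map-ev
      (λ n → component≤ 0<ε (seq (im z) n) (0≤p² (seq (re z) n))
           ∘ subst (ℚ._≤ ε ℚ.* ε) (ℚ.+-comm (seq (re z) n ℚ.* seq (re z) n) (seq (im z) n ℚ.* seq (im z) n)))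
      (sq ε 0<ε))
  where
  sq : ∀ ε → 0ℚ ℚ.< ε → Eventually λ n → seq ∣ z ∣² n ℚ.≤ ε ℚ.* ε
  sq ε 0<ε = map-ev (λ n → subst (λ t → seq ∣ z ∣² n ℚ.≤ t ℚ.* t) (½+½ ε))
    (sq≤ (h (½ ℚ.* ε) (0<½* 0<ε)) (½ ℚ.* ε) (0<½* 0<ε))
  component≤ : ∀ {ε} → 0ℚ ℚ.< ε → ∀ p {s} → 0ℚ ℚ.≤ s → p ℚ.* p ℚ.+ s ℚ.≤ ε ℚ.* ε → ℚ.∣ p ℚ.- 0ℚ ∣ ℚ.≤ ε
  component≤ {ε} 0<ε p {s} 0≤s le = subst (λ t → ℚ.∣ t ∣ ℚ.≤ ε) (sym (ℚ.+-identityʳ p))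
    (sq-cancel-≤ {ℚ.∣ p ∣} (ℚ.<⇒≤ 0<ε)
      (subst (ℚ._≤ ε ℚ.* ε) (trans (sym (ℚ.0≤p⇒∣p∣≡p (0≤p² p))) (ℚ.∣p*q∣≡∣p∣*∣q∣ p p))
        (ℚ.≤-trans (p≤p+ (p ℚ.* p) 0≤s) le)))

≼-sum : ∀ {n} (v : Vector ℂ n) {b} → 0ℚ ℚ.≤ b → (∀ i → v i ≼ b) → sumᶜ v ≼ fromℕ n ℚ.* b
≼-sum {zero}  v {b} 0≤b h = 0≼ (0≤* {0ℚ} {b} ℚ.≤-refl 0≤b)
≼-sum {suc n} v {b} 0≤b h = subst (sumᶜ v ≼_)
  (solve 2 (λ k b → b :+ k :* b := (con 1ℚ :+ k) :* b) refl (fromℕ n) b)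
  (≼-+ (h Fin.zero) (≼-sum (tail v) 0≤b (λ i → h (Fin.suc i))))

-- Rational bounds compared with the real-valued modulus.

<⇒≤ᴿ : ∀ {x y} → x <ᴿ y → x ≤ᴿ y
<⇒≤ᴿ {x} {y} (mk< γ 0<γ h) = mk≤ λ ε 0<ε → map-ev
  (λ n le → ℚ.≤-trans (ℚ.≤-trans (p≤p+ (seq x n) (ℚ.<⇒≤ 0<γ)) le) (p≤p+ (seq y n) (ℚ.<⇒≤ 0<ε))) h

module _ (z : ℂ) where

  0≤seq-∣z∣ : ∀ n → 0ℚ ℚ.≤ seq ∣ z ∣ n
  0≤seq-∣z∣ n = 0≤lower (ℚ.p≤q⊔p (seq ∣ z ∣² n) 0ℚ) n

  -- The bisection value at stage n falls short of the root of the n-th term by at most `width`,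
  -- which is eventually below ε because the terms of `∣ z ∣²` are bounded.
  seq-∣z∣²≤ : ∀ {ε} → 0ℚ ℚ.< ε →
    Eventually λ n → seq ∣ z ∣² n ℚ.≤ (seq ∣ z ∣ n ℚ.+ ε) ℚ.* (seq ∣ z ∣ n ℚ.+ ε)
  seq-∣z∣²≤ {ε} 0<ε =
    let b , 0<b , hb = bounded ∣ z ∣²
        N , small    = width-⊔0-small 0<b 0<ε
    in zip-ev (λ n ∣p∣≤b width≤ε →
         let p   = seq ∣ z ∣² n
             0≤p = ℚ.p≤q⊔p p 0ℚ
         in ℚ.≤-trans (ℚ.p≤p⊔q p 0ℚ) (ℚ.≤-trans (≤upper² 0≤p n)
              (sq-mono-≤ {seq ∣ z ∣ n ℚ.+ width (p ℚ.⊔ 0ℚ) n}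
                (0≤+ {seq ∣ z ∣ n} (0≤seq-∣z∣ n) (0≤width 0≤p n))
                (ℚ.+-monoʳ-≤ (seq ∣ z ∣ n) (width≤ε p ∣p∣≤b)))))
       hb (N , small)

  -- No slack is lost in this direction, since bisection approaches the root from below.
  seq-∣z∣≤ : ∀ {b} n → 0ℚ ℚ.≤ b → seq ∣ z ∣² n ℚ.≤ b ℚ.* b → seq ∣ z ∣ n ℚ.≤ b
  seq-∣z∣≤ {b} n 0≤b h = sq-cancel-≤ {seq ∣ z ∣ n} 0≤b
    (ℚ.≤-trans (lower²≤ (ℚ.p≤q⊔p (seq ∣ z ∣² n) 0ℚ) n) (ℚ.⊔-lub h (0≤p² b)))

  ≤ᴿ⇒≼ : ∀ {b} → 0ℚ ℚ.≤ b → ∣ z ∣ ≤ᴿ fromℚ b → z ≼ b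
  ≤ᴿ⇒≼ {b} 0≤b (mk≤ h) = mk≼ 0≤b λ ε 0<ε → zip-ev
    (λ n sq≤ ∣z∣≤ → ℚ.≤-trans sq≤
      (sq-mono-≤ {seq ∣ z ∣ n ℚ.+ ½ ℚ.* ε}
        (0≤+ {seq ∣ z ∣ n} (0≤seq-∣z∣ n) (ℚ.<⇒≤ (0<½* 0<ε)))
        (subst (seq ∣ z ∣ n ℚ.+ ½ ℚ.* ε ℚ.≤_)
          (trans (ℚ.+-assoc b (½ ℚ.* ε) (½ ℚ.* ε)) (cong (b ℚ.+_) (½+½ ε)))
          (ℚ.+-monoˡ-≤ (½ ℚ.* ε) ∣z∣≤))))
    (seq-∣z∣²≤ (0<½* 0<ε)) (h (½ ℚ.* ε) (0<½* 0<ε))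

  ≼⇒≤ᴿ : ∀ {b} → z ≼ b → ∣ z ∣ ≤ᴿ fromℚ b
  ≼⇒≤ᴿ {b} (mk≼ 0≤b h) = mk≤ λ ε 0<ε →
    map-ev (λ n → seq-∣z∣≤ n (0≤+ {b} 0≤b (ℚ.<⇒≤ 0<ε))) (h ε 0<ε)

  -- One late term of the Cauchy sequence, raised by ε/2, bounds the modulus and overshoots it by at
  -- most ε. Tightness matters when several such bounds are added and the total must stay below 1.
  tight-bound : ∀ {ε} → 0ℚ ℚ.< ε → ∃ λ s → z ≼ s × Eventually λ n → s ℚ.≤ seq ∣ z ∣ n ℚ.+ ε
  tight-bound {ε} 0<ε =
    let N , h = cauchy ∣ z ∣ (½ ℚ.* ε) (0<½* 0<ε)
        c = seq ∣ z ∣ N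
        s = c ℚ.+ ½ ℚ.* ε
    in s
     , ≤ᴿ⇒≼ (0≤+ {c} (0≤seq-∣z∣ N) (ℚ.<⇒≤ (0<½* 0<ε)))
         (mk≤ λ η 0<η → N , λ n N≤n →
           ℚ.≤-trans (∣p-q∣≤⇒p≤q+ {seq ∣ z ∣ n} {c} (h n N N≤n ℕ.≤-refl)) (p≤p+ s (ℚ.<⇒≤ 0<η)))
     , N , λ n N≤n → subst (s ℚ.≤_)
         (trans (ℚ.+-assoc (seq ∣ z ∣ n) (½ ℚ.* ε) (½ ℚ.* ε)) (cong (seq ∣ z ∣ n ℚ.+_) (½+½ ε)))
         (ℚ.+-monoˡ-≤ (½ ℚ.* ε) (∣p-q∣≤⇒p≤q+ {c} {seq ∣ z ∣ n} (h N n ℕ.≤-refl N≤n)))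

≼-bounded : ∀ z → ∃ λ b → z ≼ b
≼-bounded z = let s , z≼s , _ = tight-bound z (ℚ.positive⁻¹ 1ℚ) in s , z≼s

<1⇒≼ : ∀ z → ∣ z ∣ <ᴿ 1ᴿ → ∃ λ ρ → ρ ℚ.< 1ℚ × z ≼ ρ
<1⇒≼ z (mk< γ 0<γ (N , h)) = 1ℚ ℚ.- γ
  , subst (1ℚ ℚ.- γ ℚ.<_) (ℚ.+-identityʳ 1ℚ) (ℚ.+-monoʳ-< 1ℚ (ℚ.neg-antimono-< 0<γ))
  , ≤ᴿ⇒≼ z (ℚ.≤-trans (0≤seq-∣z∣ z N) (≤1-γ N ℕ.≤-refl))
      (mk≤ λ ε 0<ε → N , λ n N≤n → ℚ.≤-trans (≤1-γ n N≤n) (p≤p+ (1ℚ ℚ.- γ) (ℚ.<⇒≤ 0<ε)))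
  where
  ≤1-γ : ∀ n → N ℕ.≤ n → seq ∣ z ∣ n ℚ.≤ 1ℚ ℚ.- γ
  ≤1-γ n N≤n = by (1ℚ ℚ.- (seq ∣ z ∣ n ℚ.+ γ))
    (solve 2 (λ s γ → con 1ℚ :- γ :- s := con 1ℚ :- (s :+ γ)) refl (seq ∣ z ∣ n) γ) (≤⇒0≤ (h n N≤n))

-- Serves to replace the real Lipschitz constant by a rational one that eventually dominates its
-- terms.
≤*ᴿ⇒≼ : ∀ {x μ} → 0ℚ ℚ.< μ → Eventually (λ n → seq x n ℚ.≤ μ) →
  ∀ {z w b} → w ≼ b → ∣ z ∣ ≤ᴿ x *ᴿ ∣ w ∣ → z ≼ μ ℚ.* b
≤*ᴿ⇒≼ {x} {μ} 0<μ x≤μ {z} {w} {b} w≼b le = ≤ᴿ⇒≼ z (0≤* {μ} (ℚ.<⇒≤ 0<μ) (0≤bound w≼b))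
  (≤ᴿ-trans le (mk≤ λ ε 0<ε →
    let δ , 0<δ , μδ = quotient 0<μ 0<ε
    in zip-ev
      (λ n xₙ≤μ ∣w∣≤ → subst (seq x n ℚ.* seq ∣ w ∣ n ℚ.≤_)
        (trans (ℚ.*-distribˡ-+ μ b δ) (cong (μ ℚ.* b ℚ.+_) μδ))
        (ℚ.≤-trans
          (ℚ.*-monoʳ-≤-nonNeg (seq ∣ w ∣ n) {{ℚ.nonNegative (0≤seq-∣z∣ w n)}} xₙ≤μ)
          (ℚ.*-monoˡ-≤-nonNeg μ {{ℚ.nonNegative (ℚ.<⇒≤ 0<μ)}} ∣w∣≤)))
      x≤μ (below (≼⇒≤ᴿ w w≼b) δ 0<δ)))

-- Norm bounds for linear functionals with respect to the maximum norm.

WeightedBound : ∀ {n} → Vector ℂ n → ℚ → Set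
WeightedBound {n} c κ = ∀ (x : Vector ℂ n) {b} → 0ℚ ℚ.≤ b → (∀ i → x i ≼ b) →
  sumᶜ (λ i → c i *ᶜ x i) ≼ κ ℚ.* b

-- The natural constant Σ ∣cᵢ∣ is a real number, so it is rounded up to a rational: the first entry
-- may overshoot by ε/2, the remaining ones together by ε/2.
tight-weightedBound : ∀ {n} (c : Vector ℂ n) {ε} → 0ℚ ℚ.< ε →
  ∃ λ κ → 0ℚ ℚ.≤ κ × WeightedBound c κ × Eventually λ k → κ ℚ.≤ seq (sumᴿ (λ i → ∣ c i ∣)) k ℚ.+ ε
tight-weightedBound {zero} c {ε} 0<ε = 0ℚ , ℚ.≤-refl
  , (λ x {b} 0≤b h → 0≼ (0≤* {0ℚ} {b} ℚ.≤-refl 0≤b))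
  , always λ _ → 0≤+ {0ℚ} {ε} ℚ.≤-refl (ℚ.<⇒≤ 0<ε)
tight-weightedBound {suc n} c {ε} 0<ε =
  let s , c₀≼s , hs = tight-bound (c Fin.zero) (0<½* 0<ε)
      κ , 0≤κ , bound , hκ = tight-weightedBound (tail c) (0<½* 0<ε)
  in s ℚ.+ κ , 0≤+ {s} (0≤bound c₀≼s) 0≤κ
   , (λ x {b} 0≤b h → subst (_ ≼_) (sym (ℚ.*-distribʳ-+ b s κ))
       (≼-+ (≼-* c₀≼s (h Fin.zero)) (bound (tail x) 0≤b (λ i → h (Fin.suc i)))))
   , zip-ev (λ k s≤ κ≤ → subst (s ℚ.+ κ ℚ.≤_)
       (solve 3 (λ a b ε → (a :+ con ½ :* ε) :+ (b :+ con ½ :* ε) := a :+ b :+ ε) refl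
         (seq ∣ c Fin.zero ∣ k) (seq (sumᴿ (λ i → ∣ tail c i ∣)) k) ε)
       (ℚ.+-mono-≤ s≤ κ≤)) hs hκ

-- Half of the gap γ below 1 pays for rounding the sum up; the other half keeps κ < 1.
weightedBound-<1 : ∀ {n} (c : Vector ℂ n) → sumᴿ (λ i → ∣ c i ∣) <ᴿ 1ᴿ →
  ∃ λ κ → 0ℚ ℚ.≤ κ × κ ℚ.< 1ℚ × WeightedBound c κ
weightedBound-<1 c (mk< γ 0<γ h) =
  let κ , 0≤κ , bound , hκ = tight-weightedBound c (0<½* 0<γ)
      N , κ+½γ≤1 = zip-ev (λ n κ≤ s+γ≤1 → ℚ.≤-trans (ℚ.+-monoˡ-≤ (½ ℚ.* γ) κ≤)
          (subst (ℚ._≤ 1ℚ) (sym (trans (ℚ.+-assoc (seq (sumᴿ (λ i → ∣ c i ∣)) n) (½ ℚ.* γ) (½ ℚ.* γ))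
            (cong (seq (sumᴿ (λ i → ∣ c i ∣)) n ℚ.+_) (½+½ γ)))) s+γ≤1)) hκ h
  in κ , 0≤κ
   , ℚ.<-≤-trans (subst (ℚ._< κ ℚ.+ ½ ℚ.* γ) (ℚ.+-identityʳ κ) (ℚ.+-monoʳ-< κ (0<½* 0<γ)))
       (κ+½γ≤1 N ℕ.≤-refl)
   , bound

-- Geometric decay.

p<1⇒0<1-p : ∀ {p} → p ℚ.< 1ℚ → 0ℚ ℚ.< 1ℚ ℚ.- p
p<1⇒0<1-p {p} p<1 = subst (ℚ._< 1ℚ ℚ.- p) (ℚ.+-inverseʳ p) (ℚ.+-monoˡ-< (ℚ.- p) p<1)

module Geometric {ρ : ℚ} (0≤ρ : 0ℚ ℚ.≤ ρ) (ρ<1 : ρ ℚ.< 1ℚ) where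

  private
    0≤1 = ℚ.nonNegative⁻¹ 1ℚ
    0<1-ρ = p<1⇒0<1-p ρ<1

  0≤ρ^ : ∀ n → 0ℚ ℚ.≤ ρ ^ℚ n
  0≤ρ^ zero    = 0≤1
  0≤ρ^ (suc n) = 0≤* {ρ} 0≤ρ (0≤ρ^ n)

  ρ^≤1 : ∀ n → ρ ^ℚ n ℚ.≤ 1ℚ
  ρ^≤1 zero    = ℚ.≤-refl
  ρ^≤1 (suc n) = ℚ.≤-trans (*-≤1 ρ (ρ ^ℚ n) 0≤ρ (ρ^≤1 n)) (ℚ.<⇒≤ ρ<1)

  -- The left-hand side is at most (1 - ρ) (1 + ρ + ⋯ + ρⁿ⁻¹).
  n[1-ρ]ρⁿ≤1-ρⁿ : ∀ n → fromℕ n ℚ.* (1ℚ ℚ.- ρ) ℚ.* ρ ^ℚ n ℚ.≤ 1ℚ ℚ.- ρ ^ℚ n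
  n[1-ρ]ρⁿ≤1-ρⁿ zero    = ℚ.≤-reflexive
    (solve 1 (λ ρ → con 0ℚ :* (con 1ℚ :- ρ) :* con 1ℚ := con 1ℚ :- con 1ℚ) refl ρ)
  n[1-ρ]ρⁿ≤1-ρⁿ (suc n) =
    by (ρ ℚ.* (1ℚ ℚ.- t ℚ.- k ℚ.* (1ℚ ℚ.- ρ) ℚ.* t) ℚ.+ (1ℚ ℚ.- ρ) ℚ.* (1ℚ ℚ.- ρ ℚ.* t))
       (solve 3 (λ k ρ t →
          con 1ℚ :- ρ :* t :- (con 1ℚ :+ k) :* (con 1ℚ :- ρ) :* (ρ :* t)
            := ρ :* (con 1ℚ :- t :- k :* (con 1ℚ :- ρ) :* t) :+ (con 1ℚ :- ρ) :* (con 1ℚ :- ρ :* t))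
          refl k ρ t)
       (0≤+ {ρ ℚ.* (1ℚ ℚ.- t ℚ.- k ℚ.* (1ℚ ℚ.- ρ) ℚ.* t)}
         (0≤* {ρ} 0≤ρ (≤⇒0≤ (n[1-ρ]ρⁿ≤1-ρⁿ n)))
         (0≤* {1ℚ ℚ.- ρ} (ℚ.<⇒≤ 0<1-ρ) (≤⇒0≤ (ρ^≤1 (suc n)))))
    where
    k = fromℕ n
    t = ρ ^ℚ n

  -- Once C ≤ ε(1 - ρ)n, the preceding inequality gives C ρⁿ ≤ ε(1 - ρⁿ) ≤ ε.
  ρⁿ-null : ∀ {C ε} → 0ℚ ℚ.≤ C → 0ℚ ℚ.< ε → Eventually λ n → C ℚ.* ρ ^ℚ n ℚ.≤ ε
  ρⁿ-null {C} {ε} 0≤C 0<ε =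
    let 0<σ = 0<* 0<ε 0<1-ρ
        c , 0<c , σc = quotient 0<σ (ℚ.+-mono-≤-< {0ℚ} {C} 0≤C (ℚ.positive⁻¹ 1ℚ))
        N , c≤N = archimedean c
    in N , λ n N≤n →
      let σ = ε ℚ.* (1ℚ ℚ.- ρ)
          k = fromℕ n
          t = ρ ^ℚ n
          C≤ : C ℚ.≤ σ ℚ.* k
          C≤ = ℚ.≤-trans (p≤p+ C 0≤1) (subst (ℚ._≤ σ ℚ.* k) σc
            (ℚ.*-monoˡ-≤-nonNeg σ {{ℚ.nonNegative (ℚ.<⇒≤ 0<σ)}} (ℚ.≤-trans c≤N (fromℕ-mono N≤n))))
      in ℚ.≤-trans (ℚ.*-monoʳ-≤-nonNeg t {{ℚ.nonNegative (0≤ρ^ n)}} C≤)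
        (by (ε ℚ.* (1ℚ ℚ.- t ℚ.- k ℚ.* (1ℚ ℚ.- ρ) ℚ.* t) ℚ.+ ε ℚ.* t)
          (solve 4 (λ ε ρ k t → ε :- ε :* (con 1ℚ :- ρ) :* k :* t
              := ε :* (con 1ℚ :- t :- k :* (con 1ℚ :- ρ) :* t) :+ ε :* t) refl ε ρ k t)
          (0≤+ {ε ℚ.* (1ℚ ℚ.- t ℚ.- k ℚ.* (1ℚ ℚ.- ρ) ℚ.* t)}
            (0≤* {ε} (ℚ.<⇒≤ 0<ε) (≤⇒0≤ (n[1-ρ]ρⁿ≤1-ρⁿ n)))
            (0≤* {ε} (ℚ.<⇒≤ 0<ε) (0≤ρ^ n))))

-- Summation by parts.

private module CR = CommutativeRing ℂ-commutativeRing
open RingProperties CR.ring using (+-cancelʳ; x≈y⇒x∙y⁻¹≈ε; x∙y⁻¹≈ε⇒x≈y; x[y-z]≈xy-xz)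
open SemiringExp CR.semiring using (^-homo-*)
open SemiringSum CR.semiring using (sum-cong-≋; sum-replicate-zero; ∑-distrib-+)
open SetoidReasoning ℂ-setoid

dot : ∀ {n} → Vector ℂ n → (ℕ → ℂ) → ℂ
dot {n} w x = sumᶜ (λ (i : Fin n) → w i *ᶜ x (toℕ i))

tailSums : ∀ {n} → Vector ℂ n → Vector ℂ n
tailSums w i = sumFromᶜ (toℕ i) w

-- It rests on c_i = w_{i+1} + c_{i+1}. If c_0 = 1 and x_0 = Σ w_i x_i, the identity says that Σ c_i
-- x_i does not change when x is shifted by one place.
summation-by-parts : ∀ {n} (w : Vector ℂ n) (x : ℕ → ℂ) →
  dot (tailSums w) x +ᶜ dot w (x ∘ suc) ≈ᶜ sumᶜ w *ᶜ x 0 +ᶜ dot (tailSums w) (x ∘ suc)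
summation-by-parts {zero}  w x = CR.+-congʳ {0ᶜ} (CR.sym (CR.zeroˡ (x 0)))
summation-by-parts {suc n} w x = begin
  (s +ᶜ A) +ᶜ (u +ᶜ L)            ≈⟨ CR.+-assoc s A (u +ᶜ L) ⟩
  s +ᶜ (A +ᶜ (u +ᶜ L))            ≈⟨ CR.+-congˡ (CR.sym (CR.+-assoc A u L)) ⟩
  s +ᶜ ((A +ᶜ u) +ᶜ L)            ≈⟨ CR.+-congˡ (CR.+-congʳ (CR.+-comm A u)) ⟩
  s +ᶜ ((u +ᶜ A) +ᶜ L)            ≈⟨ CR.+-congˡ (CR.+-assoc u A L) ⟩
  s +ᶜ (u +ᶜ (A +ᶜ L))            ≈⟨ CR.+-congˡ (CR.+-congˡ (summation-by-parts (tail w) (x ∘ suc))) ⟩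
  s +ᶜ (u +ᶜ (S′ *ᶜ x 1 +ᶜ B))    ≈⟨ CR.+-congˡ (CR.sym (CR.+-assoc u (S′ *ᶜ x 1) B)) ⟩
  s +ᶜ ((u +ᶜ S′ *ᶜ x 1) +ᶜ B)    ≈⟨ CR.+-congˡ (CR.+-congʳ (CR.sym (CR.distribʳ (x 1) (w Fin.zero) S′))) ⟩
  s +ᶜ (sumᶜ w *ᶜ x 1 +ᶜ B)       ∎
  where
  S′ = sumᶜ (tail w)
  s = sumᶜ w *ᶜ x 0
  u = w Fin.zero *ᶜ x 1
  A = dot (tailSums (tail w)) (x ∘ suc)
  L = dot (tail w) (x ∘ suc ∘ suc)
  B = dot (tailSums (tail w)) (x ∘ suc ∘ suc)

-- Backward descent for the perturbed recurrence.

descend : (Q : ℕ → Set) → ∀ {n₀} → (∀ m → n₀ ℕ.≤ m → Q (suc m) → Q m) →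
  ∀ t → Q (t ℕ.+ n₀) → Q n₀
descend Q {n₀} step zero    q = q
descend Q {n₀} step (suc t) q = descend Q step t (step (t ℕ.+ n₀) (ℕ.m≤n+m n₀ t) q)

from-suc : ∀ {P : ℕ → Set} {m} → P m → (∀ j → suc m ℕ.≤ j → P j) → ∀ j → m ℕ.≤ j → P j
from-suc p ps j m≤j with ℕ.m≤n⇒m<n∨m≡n m≤j
... | inj₁ m<j  = ps j m<j
... | inj₂ refl = p

-- The problem along a single orbit: `α m` holds the coefficients at z qᵐ, `h` is the difference of
-- two solutions there, and C ρᵐ comes from the Lipschitz condition at 0.
module _ {n}
  (w : Vector ℂ (suc n)) (∑w≈1 : sumᶜ w ≈ᶜ 1ᶜ)
  {κ} (0≤κ : 0ℚ ℚ.≤ κ) (κ<1 : κ ℚ.< 1ℚ)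
  (tails : WeightedBound (tailSums (tail w)) κ)
  (α : ℕ → Vector ℂ (suc n)) {C ρ} (0≤C : 0ℚ ℚ.≤ C) (0≤ρ : 0ℚ ℚ.≤ ρ) (ρ<1 : ρ ℚ.< 1ℚ)
  (α-near : ∀ m i → α m i -ᶜ w i ≼ C ℚ.* ρ ^ℚ m)
  (h : ℕ → ℂ) (rec : ∀ m → h m ≈ᶜ dot (α m) (λ k → h (m ℕ.+ suc k)))
  (h-null : ∀ ε → 0ℚ ℚ.< ε → Eventually λ m → h m ≼ ε)
  where

  open Geometric 0≤ρ ρ<1

  private

    err tails·h : ℕ → ℂ
    err m     = dot (λ i → α m i -ᶜ w i) (λ k → h (m ℕ.+ suc k))
    tails·h m = dot (tailSums (tail w)) (λ k → h (m ℕ.+ suc k))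

    P : ℕ → ℂ
    P m = dot (tailSums w) (λ k → h (m ℕ.+ k))

    ∑w*h≈h : ∀ m → sumᶜ w *ᶜ h (m ℕ.+ 0) ≈ᶜ h m
    ∑w*h≈h m = begin
      sumᶜ w *ᶜ h (m ℕ.+ 0) ≈⟨ CR.*-cong ∑w≈1 (CR.reflexive (cong h (ℕ.+-identityʳ m))) ⟩
      1ᶜ *ᶜ h m             ≈⟨ CR.*-identityˡ (h m) ⟩
      h m                   ∎

    P≈h+tails : ∀ m → P m ≈ᶜ h m +ᶜ tails·h m
    -- By computation `P m` is c_0 h_{m+0} plus `tails·h m`, so only the first term has to be
    -- rewritten.
    P≈h+tails m = CR.+-congʳ {tails·h m} (∑w*h≈h m)

    h≈P-tails : ∀ m → h m ≈ᶜ P m +ᶜ -ᶜ tails·h m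
    h≈P-tails m = begin
      h m                                    ≈⟨ CR.sym (CR.+-identityʳ (h m)) ⟩
      h m +ᶜ 0ᶜ                              ≈⟨ CR.+-congˡ (CR.sym (CR.-‿inverseʳ (tails·h m))) ⟩
      h m +ᶜ (tails·h m +ᶜ -ᶜ tails·h m)     ≈⟨ CR.sym (CR.+-assoc (h m) (tails·h m) (-ᶜ tails·h m)) ⟩
      h m +ᶜ tails·h m +ᶜ -ᶜ tails·h m       ≈⟨ CR.+-congʳ (CR.sym (P≈h+tails m)) ⟩
      P m +ᶜ -ᶜ tails·h m                    ∎

    -- Summation by parts gives P_m + W = h_m + P_{m+1}. Splitting the coefficients into `w` and
    -- their deviation turns h_m into e_m + W, and W cancels.
    P-step : ∀ m → P m ≈ᶜ P (suc m) +ᶜ err m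
    P-step m = +-cancelʳ W (P m) (P (suc m) +ᶜ err m) (begin
      P m +ᶜ W                                    ≈⟨ summation-by-parts w (λ k → h (m ℕ.+ k)) ⟩
      sumᶜ w *ᶜ h (m ℕ.+ 0) +ᶜ P′                 ≈⟨ CR.+-cong (CR.trans (∑w*h≈h m) h≈err+W) P′≈P ⟩
      (err m +ᶜ W) +ᶜ P (suc m)                   ≈⟨ CR.+-comm (err m +ᶜ W) (P (suc m)) ⟩
      P (suc m) +ᶜ (err m +ᶜ W)                   ≈⟨ CR.sym (CR.+-assoc (P (suc m)) (err m) W) ⟩
      P (suc m) +ᶜ err m +ᶜ W                     ∎)
      where
      W  = dot w (λ k → h (m ℕ.+ suc k))
      P′ = dot (tailSums w) (λ k → h (m ℕ.+ suc k))
      P′≈P : P′ ≈ᶜ P (suc m)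
      P′≈P = sum-cong-≋ {suc n} λ i → CR.*-congˡ {tailSums w i} (CR.reflexive (cong h (ℕ.+-suc m (toℕ i))))
      split : ∀ a b x → a *ᶜ x ≈ᶜ (a -ᶜ b) *ᶜ x +ᶜ b *ᶜ x
      split a b x = begin
        a *ᶜ x                       ≈⟨ CR.*-congʳ (CR.sym (CR.+-identityʳ a)) ⟩
        (a +ᶜ 0ᶜ) *ᶜ x               ≈⟨ CR.*-congʳ (CR.+-congˡ (CR.sym (CR.-‿inverseˡ b))) ⟩
        (a +ᶜ (-ᶜ b +ᶜ b)) *ᶜ x      ≈⟨ CR.*-congʳ (CR.sym (CR.+-assoc a (-ᶜ b) b)) ⟩
        ((a -ᶜ b) +ᶜ b) *ᶜ x         ≈⟨ CR.distribʳ x (a -ᶜ b) b ⟩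
        (a -ᶜ b) *ᶜ x +ᶜ b *ᶜ x      ∎
      x : Vector ℂ (suc n)
      x i = h (m ℕ.+ suc (toℕ i))
      h≈err+W : h m ≈ᶜ err m +ᶜ W
      h≈err+W = begin
        h m                                             ≈⟨ rec m ⟩
        sumᶜ (λ i → α m i *ᶜ x i)                       ≈⟨ sum-cong-≋ (λ i → split (α m i) (w i) (x i)) ⟩
        sumᶜ (λ i → (α m i -ᶜ w i) *ᶜ x i +ᶜ w i *ᶜ x i)
          ≈⟨ ∑-distrib-+ (λ i → (α m i -ᶜ w i) *ᶜ x i) (λ i → w i *ᶜ x i) ⟩
        err m +ᶜ W                                      ∎

    0<1-κ = p<1⇒0<1-p κ<1

    4ℚ = fromℕ 4
    -- The error e_m has d terms, each at most C ρᵐ times a bound for the later values of `h`.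
    D = fromℕ (suc n) ℚ.* C

    0≤D : 0ℚ ℚ.≤ D
    0≤D = 0≤* {fromℕ (suc n)} (fromℕ-mono {0} {suc n} ℕ.z≤n) 0≤C

    -- T ρᵐ dominates D (ρᵐ + ρᵐ⁺¹ + ⋯); the summand 1 only serves to make it positive.
    ∃T : ∃ λ T → 0ℚ ℚ.< T × (1ℚ ℚ.- ρ) ℚ.* T ≡ D ℚ.+ 1ℚ
    ∃T = quotient (p<1⇒0<1-p ρ<1) (ℚ.+-mono-≤-< {0ℚ} {D} 0≤D (ℚ.positive⁻¹ 1ℚ))

    T = proj₁ ∃T
    0≤T = ℚ.<⇒≤ (proj₁ (proj₂ ∃T))

    -- The 4 makes ½ (1 - κ) K δ equal to the allowance 2δ of the invariant.
    ∃K : ∃ λ K → 0ℚ ℚ.< K × (1ℚ ℚ.- κ) ℚ.* K ≡ 4ℚ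
    ∃K = quotient 0<1-κ (ℚ.positive⁻¹ 4ℚ)

    K = proj₁ ∃K
    0≤K = ℚ.<⇒≤ (proj₁ (proj₂ ∃K))
    [1-κ]K≡4 = proj₂ (proj₂ ∃K)

    -- From n₀ on, the accumulated errors use up at most half of the margin 1 - κ. The choice
    -- precedes that of δ.
    ∃n₀ : Eventually λ m → T ℚ.* ρ ^ℚ m ℚ.≤ ½ ℚ.* (1ℚ ℚ.- κ)
    ∃n₀ = ρⁿ-null 0≤T (0<½* 0<1-κ)

    n₀ = proj₁ ∃n₀

    1≤K : 1ℚ ℚ.≤ K
    1≤K = by (fromℕ 3 ℚ.+ κ ℚ.* K)
      (trans (solve 2 (λ κ K → K :- con 1ℚ := ((con 1ℚ :- κ) :* K :- con 1ℚ) :+ κ :* K) refl κ K)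
        (cong (λ t → t ℚ.- 1ℚ ℚ.+ κ ℚ.* K) [1-κ]K≡4))
      (0≤+ {fromℕ 3} (ℚ.nonNegative⁻¹ (fromℕ 3)) (0≤* {κ} 0≤κ 0≤K))

    module _ {δ} (0<δ : 0ℚ ℚ.< δ) where

      B 2δ : ℚ
      B = K ℚ.* δ
      2δ = δ ℚ.+ δ

      0≤δ = ℚ.<⇒≤ 0<δ
      0≤B : 0ℚ ℚ.≤ B
      0≤B = 0≤* {K} 0≤K 0≤δ

      -- Passing a bound on `h` back through the recurrence alone could enlarge it at every step,
      -- since Σ ∣w_i∣ ≥ 1. The bound on `P` grows only by the errors, so `h` keeps the same bound B
      -- throughout: 2δ allows for the start, T ρᵐ B for the errors.
      Invariant : ℕ → Set
      Invariant m = (∀ j → m ℕ.≤ j → h j ≼ B) × P m ≼ 2δ ℚ.+ T ℚ.* ρ ^ℚ m ℚ.* B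

      -- As P_m = h_m + Σ_{i≥1} c_i h_{m+i}, it is at most (1 + κ)δ ≤ 2δ.
      initially : ∀ m → (∀ j → m ℕ.≤ j → h j ≼ δ) → Invariant m
      initially m hs =
          (λ j m≤j → ≼-weaken δ≤B (hs j m≤j))
        , ≼-resp-≈ (CR.sym (P≈h+tails m)) (≼-weaken
            (by ((1ℚ ℚ.- κ) ℚ.* δ ℚ.+ T ℚ.* ρ ^ℚ m ℚ.* B)
              (solve 3 (λ κ δ x → δ :+ δ :+ x :- (δ :+ κ :* δ) := (con 1ℚ :- κ) :* δ :+ x) refl
                κ δ (T ℚ.* ρ ^ℚ m ℚ.* B))
              (0≤+ {(1ℚ ℚ.- κ) ℚ.* δ} (0≤* {1ℚ ℚ.- κ} (ℚ.<⇒≤ 0<1-κ) 0≤δ)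
                (0≤* {T ℚ.* ρ ^ℚ m} (0≤* {T} 0≤T (0≤ρ^ m)) 0≤B)))
            (≼-+ (hs m ℕ.≤-refl)
                 (tails (λ i → h (m ℕ.+ suc (toℕ i))) 0≤δ (λ i → hs _ (ℕ.m≤m+n m (suc (toℕ i)))))))
        where
        δ≤B : δ ℚ.≤ B
        δ≤B = subst (ℚ._≤ B) (ℚ.*-identityˡ δ) (ℚ.*-monoʳ-≤-nonNeg δ {{ℚ.nonNegative 0≤δ}} 1≤K)

      step : ∀ m → n₀ ℕ.≤ m → Invariant (suc m) → Invariant m
      step m n₀≤m (hs , p) = from-suc hm hs , pm
        where
        t = ρ ^ℚ m
        later : ∀ (i : ℕ) → h (m ℕ.+ suc i) ≼ B
        later i = hs _ (ℕ.m<m+n m {suc i} ℕ.z<s)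
        0≤tB : 0ℚ ℚ.≤ t ℚ.* B
        0≤tB = 0≤* {t} (0≤ρ^ m) 0≤B
        err≼ : err m ≼ fromℕ (suc n) ℚ.* (C ℚ.* t ℚ.* B)
        err≼ = ≼-sum (λ (i : Fin (suc n)) → (α m i -ᶜ w i) *ᶜ h (m ℕ.+ suc (toℕ i)))
          (0≤* {C ℚ.* t} (0≤* {C} 0≤C (0≤ρ^ m)) 0≤B) (λ i → ≼-* (α-near m i) (later (toℕ i)))
        -- T ρᵐ - T ρᵐ⁺¹ = (D + 1) ρᵐ pays for the error D ρᵐ B and leaves ρᵐ B over.
        pm : P m ≼ 2δ ℚ.+ T ℚ.* t ℚ.* B
        pm = ≼-resp-≈ (CR.sym (P-step m)) (≼-weaken
          (by (t ℚ.* B)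
            (trans
              (solve 7 (λ d T ρ t B k C →
                  d :+ T :* t :* B :- (d :+ T :* (ρ :* t) :* B :+ k :* (C :* t :* B))
                    := ((con 1ℚ :- ρ) :* T :- k :* C) :* (t :* B)) refl 2δ T ρ t B (fromℕ (suc n)) C)
              (trans (cong (λ s → (s ℚ.- D) ℚ.* (t ℚ.* B)) (proj₂ (proj₂ ∃T)))
                (solve 2 (λ D x → (D :+ con 1ℚ :- D) :* x := x) refl D (t ℚ.* B))))
            0≤tB)
          (≼-+ p err≼))
        -- The bound 2δ + T ρᵐ B + κB is at most B, because 2δ = ½(1 - κ)B and T ρᵐ ≤ ½(1 - κ).
        hm : h m ≼ B
        hm = ≼-resp-≈ (CR.sym (h≈P-tails m)) (≼-weaken
          (by ((½ ℚ.* (1ℚ ℚ.- κ) ℚ.- T ℚ.* t) ℚ.* B)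
            (trans
              (solve 4 (λ κ x K δ → K :* δ :- (δ :+ δ :+ x :* (K :* δ) :+ κ :* (K :* δ))
                  := (con ½ :* (con 1ℚ :- κ) :- x) :* (K :* δ) :+ con ½ :* ((con 1ℚ :- κ) :* K :- con 4ℚ) :* δ)
                refl κ (T ℚ.* t) K δ)
              (trans (cong (λ s → (½ ℚ.* (1ℚ ℚ.- κ) ℚ.- T ℚ.* t) ℚ.* B ℚ.+ ½ ℚ.* (s ℚ.- 4ℚ) ℚ.* δ) [1-κ]K≡4)
                (solve 2 (λ x δ → x :+ con ½ :* (con 4ℚ :- con 4ℚ) :* δ := x) refl
                  ((½ ℚ.* (1ℚ ℚ.- κ) ℚ.- T ℚ.* t) ℚ.* B) δ)))
            (0≤* {½ ℚ.* (1ℚ ℚ.- κ) ℚ.- T ℚ.* t} (≤⇒0≤ (proj₂ ∃n₀ m n₀≤m)) 0≤B))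
          (≼-+ pm (≼-neg (tails (λ i → h (m ℕ.+ suc (toℕ i))) 0≤B (λ i → later (toℕ i))))))

      bounded-from-n₀ : ∀ j → n₀ ℕ.≤ j → h j ≼ B
      bounded-from-n₀ = let N , hN = h-null δ 0<δ in
        -- The start N + n₀ lies beyond both indices, and the resulting bound no longer mentions N.
        proj₁ (descend Invariant step N (initially (N ℕ.+ n₀) λ j le → hN j (ℕ.m+n≤o⇒m≤o N le)))

  vanishes : h 0 ≈ᶜ 0ᶜ
  -- This second descent runs from n₀ to 0 and loses nothing: a combination of vanishing later
  -- values vanishes.
  vanishes = descend (λ m → ∀ j → m ℕ.≤ j → h j ≈ᶜ 0ᶜ)
    (λ m _ zs → from-suc (begin
        h m                                      ≈⟨ rec m ⟩
        dot (α m) (λ k → h (m ℕ.+ suc k))        ≈⟨ sum-cong-≋ (λ i → CR.trans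
                                                      (CR.*-congˡ {α m i} (zs _ (ℕ.m<m+n m {suc (toℕ i)} ℕ.z<s)))
                                                      (CR.zeroʳ (α m i))) ⟩
        sumᶜ {suc n} (λ _ → 0ᶜ)                  ≈⟨ sum-replicate-zero (suc n) ⟩
        0ᶜ                                       ∎) zs)
    -- As n₀ does not depend on δ, the choice δ = ε / K is available for every ε at the same index
    -- j.
    n₀ (λ j le → ≼⇒≈0 λ ε 0<ε →
      let δ , 0<δ , Kδ≡ε = quotient (proj₁ (proj₂ ∃K)) 0<ε
      in subst (h j ≼_) Kδ≡ε (bounded-from-n₀ 0<δ j (ℕ.m+n≤o⇒m≤o n₀ le)))
    0 ℕ.z≤n

-- Powers, strict bounds and differences.

≼-^ : ∀ {z b} → z ≼ b → ∀ n → z ^ n ≼ b ^ℚ n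
≼-^ z≼b zero    = ev-≤⇒≼ {1ᶜ} (ℚ.nonNegative⁻¹ 1ℚ) (always λ _ → ℚ.≤-refl)
≼-^ z≼b (suc n) = ≼-* z≼b (≼-^ z≼b n)

small⇒<ᴿ : ∀ {x} → 0ᴿ <ᴿ x → ∃ λ b → 0ℚ ℚ.< b × (∀ z → z ≼ b → ∣ z ∣ <ᴿ x)
small⇒<ᴿ {x} (mk< γ 0<γ h) = b , 0<b , λ z z≼b → mk< (½ ℚ.* γ) (0<½* 0<γ) (zip-ev
  (λ n ∣z∣≤ γ≤ → ℚ.≤-trans (ℚ.+-monoˡ-≤ (½ ℚ.* γ) ∣z∣≤)
    (subst (ℚ._≤ seq x n)
      (solve 1 (λ γ → con 0ℚ :+ γ := (con ½ :* (con ½ :* γ) :+ con ½ :* (con ½ :* γ)) :+ con ½ :* γ) refl γ)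
      γ≤))
  (below (≼⇒≤ᴿ z z≼b) b 0<b) h)
  where
  -- A quarter of the gap for the bound and a quarter for the slack of `≤ᴿ` leave γ/2.
  b = ½ ℚ.* (½ ℚ.* γ)
  0<b = 0<½* (0<½* 0<γ)

minus-interchange : ∀ a b c d → (a -ᶜ b) -ᶜ (c -ᶜ d) ≈ᶜ (a -ᶜ c) -ᶜ (b -ᶜ d)
minus-interchange a b c d = ≡⇒≈ᶜ
  (λ n → swap (seq (re a) n) (seq (re b) n) (seq (re c) n) (seq (re d) n))
  (λ n → swap (seq (im a) n) (seq (im b) n) (seq (im c) n) (seq (im d) n))
  where
  swap : ∀ a b c d → (a ℚ.- b) ℚ.- (c ℚ.- d) ≡ (a ℚ.- c) ℚ.- (b ℚ.- d)
  swap = solve 4 (λ a b c d → (a :- b) :- (c :- d) := (a :- c) :- (b :- d)) refl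

+-minus-interchange : ∀ a b c d → (a -ᶜ b) +ᶜ (c -ᶜ d) ≈ᶜ (a +ᶜ c) -ᶜ (b +ᶜ d)
+-minus-interchange a b c d = ≡⇒≈ᶜ
  (λ n → swap (seq (re a) n) (seq (re b) n) (seq (re c) n) (seq (re d) n))
  (λ n → swap (seq (im a) n) (seq (im b) n) (seq (im c) n) (seq (im d) n))
  where
  swap : ∀ a b c d → (a ℚ.- b) ℚ.+ (c ℚ.- d) ≡ (a ℚ.+ c) ℚ.- (b ℚ.+ d)
  swap = solve 4 (λ a b c d → (a :- b) :+ (c :- d) := (a :+ c) :- (b :+ d)) refl

dot-minus : ∀ {n} (w : Vector ℂ n) (x y : ℕ → ℂ) → dot w (λ k → x k -ᶜ y k) ≈ᶜ dot w x -ᶜ dot w y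
dot-minus {zero}  w x y = CR.sym (CR.-‿inverseʳ 0ᶜ)
dot-minus {suc n} w x y = begin
  w₀ *ᶜ (x 0 -ᶜ y 0) +ᶜ dot (tail w) (λ k → x (suc k) -ᶜ y (suc k))
    ≈⟨ CR.+-cong (x[y-z]≈xy-xz w₀ (x 0) (y 0)) (dot-minus (tail w) (x ∘ suc) (y ∘ suc)) ⟩
  (w₀ *ᶜ x 0 -ᶜ w₀ *ᶜ y 0) +ᶜ (dot (tail w) (x ∘ suc) -ᶜ dot (tail w) (y ∘ suc))
    ≈⟨ +-minus-interchange (w₀ *ᶜ x 0) (w₀ *ᶜ y 0) (dot (tail w) (x ∘ suc)) (dot (tail w) (y ∘ suc)) ⟩
  dot w x -ᶜ dot w y ∎
  where w₀ = w Fin.zero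

z-0≈z : ∀ z → z -ᶜ 0ᶜ ≈ᶜ z
z-0≈z z = ≡⇒≈ᶜ (λ n → ℚ.+-identityʳ (seq (re z) n)) (λ n → ℚ.+-identityʳ (seq (im z) n))

-- The orbit z qᵐ.

module _ (q : ℂ) (∣q∣<1 : ∣ q ∣ <ᴿ 1ᴿ) {r : ℝ} (z : Point r) where

  orbit : ℕ → Point r
  orbit = _·q^_ q ∣q∣<1 z

  -- The points (z qᵐ) qᵏ and z qᵐ⁺ᵏ agree only up to `≈ᶜ`, so `f` must be moved between them by its
  -- congruence.
  recurrence-on-orbit : ∀ {d} (a : Vector (Fun r) d) f → SatisfiesRecurrence q ∣q∣<1 a f →
    ∀ m → (f ⟨$⟩ orbit m) ≈ᶜ dot (λ i → a i ⟨$⟩ orbit m) (λ k → f ⟨$⟩ orbit (m ℕ.+ suc k))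
  recurrence-on-orbit {d} a f rec m = CR.trans (rec (orbit m)) (sum-cong-≋ {d} λ i →
    CR.*-congˡ {a i ⟨$⟩ orbit m} (Func.cong f (begin
      (point z *ᶜ q ^ m) *ᶜ q ^ suc (toℕ i)   ≈⟨ CR.*-assoc (point z) (q ^ m) (q ^ suc (toℕ i)) ⟩
      point z *ᶜ (q ^ m *ᶜ q ^ suc (toℕ i))   ≈⟨ CR.*-congˡ {point z} (CR.sym (^-homo-* q m (suc (toℕ i)))) ⟩
      point z *ᶜ q ^ (m ℕ.+ suc (toℕ i))      ∎)))

  orbit-≼ : ∀ {R ρ} → point z ≼ R → q ≼ ρ → ∀ m → point (orbit m) ≼ R ℚ.* ρ ^ℚ m
  orbit-≼ z≼R q≼ρ m = ≼-* z≼R (≼-^ q≼ρ m)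

  -- ∣z qᵐ∣ ≤ R ρᵐ tends to 0, so continuity at the centre applies.
  limit-on-orbit : (0<r : 0ᴿ <ᴿ r) (f : Fun r) → Continuous f → ∀ ε → 0ℚ ℚ.< ε →
    Eventually λ m → (f ⟨$⟩ orbit m) -ᶜ (f ⟨$⟩ centre 0<r) ≼ ε
  limit-on-orbit 0<r f f-cont ε 0<ε =
    let ρ , ρ<1 , q≼ρ  = <1⇒≼ q ∣q∣<1
        R , z≼R        = ≼-bounded (point z)
        δ , 0<δ , near = f-cont (centre 0<r) (fromℚ ε)
                           (mk< ε 0<ε (always λ _ → ℚ.≤-reflexive (ℚ.+-identityˡ ε)))
        b , 0<b , small = small⇒<ᴿ 0<δ
    in map-ev (λ m Rρᵐ≤b →
         ≤ᴿ⇒≼ _ (ℚ.<⇒≤ 0<ε) (<⇒≤ᴿ (near (orbit m) (small _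
           (≼-resp-≈ (CR.sym (z-0≈z (point (orbit m)))) (≼-weaken Rρᵐ≤b (orbit-≼ z≼R q≼ρ m)))))))
       (Geometric.ρⁿ-null (0≤bound q≼ρ) ρ<1 (0≤bound z≼R) 0<b)

-- Uniqueness on the disc.

theorem1 : (q : ℂ) → ¬ (q ≈ᶜ 0ᶜ) → (∣q∣<1 : ∣ q ∣ <ᴿ 1ᴿ) →
    (r : ℝ) (0<r : 0ᴿ <ᴿ r) →
    (d : ℕ) → 2 ≤ d →
    (a : Vector (Fun r) d) →
    let w : Vector ℂ d
        w i = a i ⟨$⟩ centre 0<r
    in
    (∃ λ M → 0ᴿ <ᴿ M × ((i : Fin d) (z : Point r) → ∣ (a i ⟨$⟩ z) -ᶜ w i ∣ ≤ᴿ M *ᴿ ∣ point z ∣)) →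
    sumFromᴿ 1 (λ (i : Fin d) → ∣ sumFromᶜ (toℕ i) w ∣) <ᴿ 1ᴿ →
    sumᶜ w ≈ᶜ 1ᶜ →
    (f : Fun r) → Continuous f → SatisfiesRecurrence q ∣q∣<1 a f →
    (g : Fun r) → Continuous g → SatisfiesRecurrence q ∣q∣<1 a g →
    (g ⟨$⟩ centre 0<r) ≈ᶜ (f ⟨$⟩ centre 0<r) →
    (z : Point r) → (g ⟨$⟩ z) ≈ᶜ (f ⟨$⟩ z)
theorem1 q _ ∣q∣<1 r 0<r (suc n) _ a (M , _ , lipschitz) tails<1 ∑w≈1
         f f-cont f-rec g g-cont g-rec g₀≈f₀ z =
  let ρ , ρ<1 , q≼ρ         = <1⇒≼ q ∣q∣<1
      R , z≼R               = ≼-bounded (point z)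
      μ , 0<μ , ∣M∣≤μ       = bounded M
      -- For d = n + 1 the sum condition unfolds to a sum over `tailSums (tail w)`, that is, over
      -- c_1, ..., c_{d-1}.
      κ , 0≤κ , κ<1 , tails = weightedBound-<1 (tailSums (tail w)) tails<1
      α-near : ∀ m i → α m i -ᶜ w i ≼ μ ℚ.* R ℚ.* ρ ^ℚ m
      α-near m i = subst (α m i -ᶜ w i ≼_) (sym (ℚ.*-assoc μ R (ρ ^ℚ m)))
        (≤*ᴿ⇒≼ {M} 0<μ (map-ev (λ n → ℚ.≤-trans (p≤∣p∣ (seq M n))) ∣M∣≤μ)
          (orbit-≼ q ∣q∣<1 z z≼R q≼ρ m) (lipschitz i (zqᵐ m)))
      h₀≈0 = vanishes w ∑w≈1 0≤κ κ<1 tails α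
               (0≤* {μ} (ℚ.<⇒≤ 0<μ) (0≤bound z≼R)) (0≤bound q≼ρ) ρ<1 α-near h h-rec h-null
  -- The orbit starts at z q⁰, which is z times 1 and equals z only up to `≈ᶜ`.
  in CR.trans (Func.cong g (CR.sym (CR.*-identityʳ (point z))))
       (CR.trans (x∙y⁻¹≈ε⇒x≈y _ _ h₀≈0) (Func.cong f (CR.*-identityʳ (point z))))
  where
  w : Vector ℂ (suc n)
  w i = a i ⟨$⟩ centre 0<r
  zqᵐ : ℕ → Point r
  zqᵐ = orbit q ∣q∣<1 z
  α : ℕ → Vector ℂ (suc n)
  α m i = a i ⟨$⟩ zqᵐ m
  h : ℕ → ℂ
  h m = (g ⟨$⟩ zqᵐ m) -ᶜ (f ⟨$⟩ zqᵐ m)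
  h-rec : ∀ m → h m ≈ᶜ dot (α m) (λ k → h (m ℕ.+ suc k))
  h-rec m = begin
    h m
      ≈⟨ CR.+-cong (recurrence-on-orbit q ∣q∣<1 z a g g-rec m)
                   (CR.-‿cong (recurrence-on-orbit q ∣q∣<1 z a f f-rec m)) ⟩
    dot (α m) (λ k → g ⟨$⟩ zqᵐ (m ℕ.+ suc k)) -ᶜ dot (α m) (λ k → f ⟨$⟩ zqᵐ (m ℕ.+ suc k))
      ≈⟨ CR.sym (dot-minus (α m) (λ k → g ⟨$⟩ zqᵐ (m ℕ.+ suc k)) (λ k → f ⟨$⟩ zqᵐ (m ℕ.+ suc k))) ⟩
    dot (α m) (λ k → h (m ℕ.+ suc k)) ∎
  h-null : ∀ ε → 0ℚ ℚ.< ε → Eventually λ m → h m ≼ ε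
  h-null ε 0<ε = zip-ev
    (λ m g≼ f≼ → subst (h m ≼_) (½+½ ε) (≼-resp-≈ (h≈ m) (≼-+ g≼ (≼-neg f≼))))
    (limit-on-orbit q ∣q∣<1 z 0<r g g-cont (½ ℚ.* ε) (0<½* 0<ε))
    (limit-on-orbit q ∣q∣<1 z 0<r f f-cont (½ ℚ.* ε) (0<½* 0<ε))
    where
    g₀ = g ⟨$⟩ centre 0<r
    f₀ = f ⟨$⟩ centre 0<r
    -- Since g(0) = f(0), the two limits cancel and `h` tends to 0.
    h≈ : ∀ m → ((g ⟨$⟩ zqᵐ m) -ᶜ g₀) -ᶜ ((f ⟨$⟩ zqᵐ m) -ᶜ f₀) ≈ᶜ h m
    h≈ m = begin
      ((g ⟨$⟩ zqᵐ m) -ᶜ g₀) -ᶜ ((f ⟨$⟩ zqᵐ m) -ᶜ f₀)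
        ≈⟨ minus-interchange (g ⟨$⟩ zqᵐ m) g₀ (f ⟨$⟩ zqᵐ m) f₀ ⟩
      h m -ᶜ (g₀ -ᶜ f₀)      ≈⟨ CR.+-congˡ {h m} (CR.-‿cong (x≈y⇒x∙y⁻¹≈ε g₀≈f₀)) ⟩
      h m -ᶜ 0ᶜ              ≈⟨ z-0≈z (h m) ⟩
      h m                    ∎
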